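{- Nominal letrec matching with one occurrence of a single variable and a garbage-free target expression is Graph-Isomorphism-hard. That is, the Graph-Isomorphism problem reduces to the following problem: given an $LRLX$-expression $s$ that contains exactly one variable $X$, with exactly one occurrence of $X$, and a garbage-free ground $LRL$-expression $t$, decide whether there is a substitution $\sigma$ mapping $X$ to a ground $LRL$-expression such that $s\sigma\sim t$.
   Context: **Ground language $LRL$.** Let $\mathbb{A}$ be an infinite set of atoms and $\mathcal{F}$ a set of function symbols $f$ with arity $ar(f)$. The (ground) expressions of $LRL$ are $$e ::= a \mid \lambda a.e \mid (f~e_1\ldots e_{ar(f)}) \mid (\mathtt{letrec}~a_1.e_1;\ldots;a_n.e_n~\mathtt{in}~e),$$ where the binding atoms $a_1,\ldots,a_n$ of a letrec are pairwise distinct. The environment $a_1.e_1;\ldots;a_n.e_n$ is a multiset (order of bindings is irrelevant). In $\lambda a.e$ the scope of $a$ is $e$; in a letrec the scope of each $a_i$ is all of $e_1,\ldots,e_n,e$. $FA(e)$ is the set of free atoms; $a\#e$ means $a\notin FA(e)$; $M\#e$ means $a\#e$ for all $a\in M$. A permutation $\pi$ is a bijection on $\mathbb{A}$ with finite $dom(\pi)=\{a\mid\pi(a)\neq a\}$; $(a~b)$ is a swapping; $\pi\cdot e$ applies $\pi$ to all atoms of $e$, including binders. **$\alpha$-equivalence $\sim$:** $a\sim a$; if $e_i\sim e_i'$ for all $i$ then $(f~e_1\ldots e_n)\sim(f~e_1'\ldots e_n')$; if $e\sim e'$ then $\lambda a.e\sim\lambda a.e'$; if $a\#e'$ and $e\sim(a~b)\cdot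 e'$ then $\lambda a.e\sim\lambda b.e'$; and $(\mathtt{letrec}~a_1.s_1;\ldots;a_n.s_n~\mathtt{in}~r)\sim(\mathtt{letrec}~b_1.t_1;\ldots;b_n.t_n~\mathtt{in}~r')$ if there is a permutation $\pi$ with $dom(\pi)\subseteq\{a_1,\ldots,a_n\}\cup\{b_1,\ldots,b_n\}$, $\pi(b_i)=a_i$ for all $i$, $\{a_1,\ldots,a_n\}\#(\mathtt{letrec}~b_1.t_1;\ldots;b_n.t_n~\mathtt{in}~r')$, $r\sim\pi\cdot r'$ and $s_i\sim\pi\cdot t_i$ for all $i$ (bindings may first be reordered arbitrarily). **$LRLX$** extends the grammar by variables $X$ and suspensions $\pi\cdot X$; a substitution replaces variables (capture is allowed), and $(\pi\cdot X)\rho=\pi\cdot(X\rho)$. **Garbage.** An expression $t$ contains garbage iff there is a subexpression $(\mathtt{letrec}~env~\mathtt{in}~r)$ of $t$ whose environment can be split as $env=env_g;env_{ng}$ such that $env_g$ is not empty and the atoms bound by $env_g$ (i.e. the atoms $a_i$ of its bindings $a_i.e_i$) occur free neither in $env_{ng}$ (i.e. in the right-hand sides of its bindings) nor in $r$. Otherwise $t$ is garbage-free. "Graph-Isomorphism-hard" means that the Graph-Isomorphism problem is polynomial-time reducible to the problem. -}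

module Defs where

open import Data.Bool.Base using (Bool; true; false; if_then_else_)
open import Data.Bool.Properties using () renaming (_≟_ to _≟ᵇ_)
open import Data.Empty using (⊥; ⊥-elim)
open import Data.Fin.Base using (Fin)
open import Data.Fin.Permutation using (Permutation; Permutation′; _⟨$⟩ʳ_)
open import Data.Fin.Subset using (Subset; Nonempty) renaming (_∈_ to _∈ˢ_; _∉_ to _∉ˢ_)
open import Data.List.Base as List
  using (List; []; _∷_; _++_; length; concatMap; allFin; replicate)
open import Data.List.Properties using (≡-dec)
open import Data.Maybe.Base using (Maybe; just; nothing)
open import Data.Nat.Base using (ℕ; suc; _+_; _*_; _^_; _≤_)
open import Data.Product.Base using (Σ-syntax; ∃; ∃-syntax; _×_; _,_)
open import Data.Sum.Base using (_⊎_)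
open import Data.Vec.Base as Vec using (Vec; []; _∷_; lookup)
open import Data.Vec.Membership.Propositional using () renaming (_∈_ to _∈ᵛ_; _∉_ to _∉ᵛ_)
open import Data.Vec.Relation.Unary.Unique.Propositional using (Unique)
open import Data.Vec.Relation.Unary.Unique.Propositional.Properties using (map⁺)
open import Function.Base using (id)
open import Function.Bundles using (_↔_; _⇔_; mk↔ₛ′; module Inverse)
open import Function.Construct.Composition using (_↔-∘_)
open import Function.Construct.Identity using (↔-id)
open import Relation.Binary.PropositionalEquality.Core
  using (_≡_; _≢_; refl; sym; trans; cong)
open import Relation.Nullary using (¬_; Dec; does; yes; no)
open import Relation.Nullary.Negation using (contradiction)

Cell : Set
Cell = Maybe Bool

-- A two-way infinite tape: the cells left of the head (nearest first), the
-- scanned cell, and the cells right of it; all cells not listed are blank.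
record Tape : Set where
  constructor tape
  field
    left  : List Cell
    head  : Cell
    right : List Cell

open Tape public using (head)

data Move : Set where
  L N R : Move

move : Move → Tape → Tape
move L (tape []      x rs)      = tape [] nothing (x ∷ rs)
move L (tape (l ∷ ls) x rs)     = tape ls l (x ∷ rs)
move N t                        = t
move R (tape ls x [])           = tape (x ∷ ls) nothing []
move R (tape ls x (r ∷ rs))     = tape (x ∷ ls) r rs

act-tape : Cell × Move → Tape → Tape
act-tape (x , m) (tape ls _ rs) = move m (tape ls x rs)

load : List Bool → Tape
load []       = tape [] nothing []
load (b ∷ bs) = tape [] (just b) (List.map just bs)

blank : Tape
blank = load []

-- The word that starts at the head and extends to the right up to the
-- first blank.
unload : Tape → List Bool
unload (tape _ x rs) = go (x ∷ rs)
  where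
  go : List Cell → List Bool
  go []             = []
  go (nothing ∷ _)  = []
  go (just b  ∷ cs) = b ∷ go cs

-- The machine has one input tape, one output tape and `extra` work tapes,
-- all of them readable and writable.  It halts when `δ` is undefined.
record TM : Set₁ where
  field
    extra  : ℕ
    State  : Set
    finite : ∃[ q ] (State ↔ Fin q)
    start  : State
    δ      : State → Vec Cell (2 + extra) →
             Maybe (State × Vec (Cell × Move) (2 + extra))

module Run (M : TM) where
  open TM M

  Config : Set
  Config = State × Vec Tape (2 + extra)

  initial : List Bool → Config
  initial w = start , load w ∷ Vec.replicate (suc extra) blank

  output : Config → List Bool
  output (_ , _ ∷ o ∷ _) = unload o

  step : Config → Maybe Config
  step (q , ts) with δ q (Vec.map head ts)
  ... | nothing        = nothing
  ... | just (q′ , as) = just (q′ , Vec.zipWith act-tape as ts)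

  data _⇓[_]_ : Config → ℕ → Config → Set where
    halt : ∀ {c} → step c ≡ nothing → c ⇓[ 0 ] c
    next : ∀ {c c′ c″ n} → step c ≡ just c′ → c′ ⇓[ n ] c″ → c ⇓[ suc n ] c″

-- A problem is given by its instances, their encoding as words, and the set
-- of positive instances.
record Problem : Set₁ where
  field
    Instance : Set
    encode   : Instance → List Bool
    Yes      : Instance → Set

record PolyTime (A B : Problem) (f : Problem.Instance A → Problem.Instance B) : Set₁ where
  private
    module A = Problem A
    module B = Problem B
  field
    machine : TM
  open Run machine
  field
    c d e    : ℕ
    computes : ∀ x → ∃[ n ] ∃[ final ]
                 n ≤ c * length (A.encode x) ^ d + e
               × initial (A.encode x) ⇓[ n ] final
               × output final ≡ B.encode (f x)

-- Polynomial-time many-one reducibility.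
_≤ₚ_ : Problem → Problem → Set₁
A ≤ₚ B = Σ[ f ∈ (Problem.Instance A → Problem.Instance B) ]
           PolyTime A B f × (∀ x → Problem.Yes A x ⇔ Problem.Yes B (f x))

record Graph : Set where
  field
    order  : ℕ
    adj    : Fin order → Fin order → Bool
    symm   : ∀ u v → adj u v ≡ adj v u
    irrefl : ∀ u → adj u u ≡ false

_≅_ : Graph → Graph → Set
G ≅ H = Σ[ π ∈ Permutation G.order H.order ]
          (∀ u v → G.adj u v ≡ H.adj (π ⟨$⟩ʳ u) (π ⟨$⟩ʳ v))
  where
  module G = Graph G
  module H = Graph H

-- The number of vertices in unary, then the adjacency matrix row by row.
encode-graph : Graph → List Bool
encode-graph G =
  replicate order true ++ false ∷
  concatMap (λ u → List.map (adj u) (allFin order)) (allFin order)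
  where open Graph G

GraphIsomorphism : Problem
GraphIsomorphism = record
  { Instance = Graph × Graph
  ; encode   = λ (G , H) → encode-graph G ++ encode-graph H
  ; Yes      = λ (G , H) → G ≅ H
  }

Name : Set
Name = List Bool

-- Inputs of an algorithm are words, so atoms (and variables) are names over
-- a finite alphabet.
𝔸 : Set
𝔸 = Name

Var : Set
Var = Name

_≟_ : (a b : 𝔸) → Dec (a ≡ b)
_≟_ = ≡-dec _≟ᵇ_

-- Bijections on atoms.  Finiteness of dom(π) is not part of the type: below,
-- permutations are either products of swappings or have their domain bounded
-- by a finite set.
Perm : Set
Perm = 𝔸 ↔ 𝔸

_·ᵃ_ : Perm → 𝔸 → 𝔸
_·ᵃ_ = Inverse.to

·ᵃ-injective : (π : Perm) → ∀ {a b} → π ·ᵃ a ≡ π ·ᵃ b → a ≡ b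
·ᵃ-injective π {a} {b} eq =
  trans (sym (Inverse.strictlyInverseʳ π a))
        (trans (cong (Inverse.from π) eq) (Inverse.strictlyInverseʳ π b))

swapᵃ : 𝔸 → 𝔸 → 𝔸 → 𝔸
swapᵃ a b c = if does (c ≟ a) then b else if does (c ≟ b) then a else c

swapᵃ-involutive : ∀ a b c → swapᵃ a b (swapᵃ a b c) ≡ c
swapᵃ-involutive a b c with c ≟ a
swapᵃ-involutive a b c | yes c≡a with b ≟ a
... | yes b≡a = trans b≡a (sym c≡a)
... | no  _ with b ≟ b
...   | yes _   = sym c≡a
...   | no  b≢b = contradiction refl b≢b
swapᵃ-involutive a b c | no c≢a with c ≟ b
swapᵃ-involutive a b c | no c≢a | yes c≡b with a ≟ a
... | yes _   = sym c≡b
... | no  a≢a = contradiction refl a≢a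
swapᵃ-involutive a b c | no c≢a | no c≢b with c ≟ a
... | yes c≡a = contradiction c≡a c≢a
... | no  _ with c ≟ b
...   | yes c≡b = contradiction c≡b c≢b
...   | no  _   = refl

swap : 𝔸 → 𝔸 → Perm
swap a b = mk↔ₛ′ (swapᵃ a b) (swapᵃ a b) (swapᵃ-involutive a b) (swapᵃ-involutive a b)

-- Finite notation for permutations inside suspensions; `(a , b) ∷ p` stands
-- for (a b) ∘ p.
Swaps : Set
Swaps = List (𝔸 × 𝔸)

⟦_⟧ : Swaps → Perm
⟦ [] ⟧          = ↔-id 𝔸
⟦ (a , b) ∷ p ⟧ = swap a b ↔-∘ ⟦ p ⟧

-- `name` is the spelling of a function symbol in encoded expressions.
record Signature : Set₁ where
  field
    Sym            : Set
    ar             : Sym → ℕ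
    name           : Sym → Name
    name-injective : ∀ {f g} → name f ≡ name g → f ≡ g

module Language (S : Signature) where
  open Signature S

  infix 4 _∈FA_ _#_ _∼_ _⊑_

  -- Expressions with suspended variables from V.  A letrec is given by its
  -- binding atoms, the right-hand sides in the same order, and its body; the
  -- order is made irrelevant by _∼_.  A bare variable X is `susp [] X`.
  data Expr (V : Set) : Set where
    atom   : 𝔸 → Expr V
    lam    : 𝔸 → Expr V → Expr V
    app    : (f : Sym) → Vec (Expr V) (ar f) → Expr V
    letrec : ∀ {n} (as : Vec 𝔸 n) → .(Unique as) → Vec (Expr V) n → Expr V → Expr V
    susp   : Swaps → V → Expr V

  LRL LRLX : Set
  LRL  = Expr ⊥
  LRLX = Expr Var

  mutual
    _·_ : Perm → LRL → LRL
    π · atom a           = atom (π ·ᵃ a)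
    π · lam a e          = lam (π ·ᵃ a) (π · e)
    π · app f es         = app f (π ·* es)
    π · letrec as u es e =
      letrec (Vec.map (π ·ᵃ_) as) (map⁺ (·ᵃ-injective π) u) (π ·* es) (π · e)

    _·*_ : ∀ {n} → Perm → Vec LRL n → Vec LRL n
    π ·* []       = []
    π ·* (e ∷ es) = (π · e) ∷ (π ·* es)

  mutual
    subst : ∀ {V} → (V → LRL) → Expr V → LRL
    subst σ (atom a)           = atom a
    subst σ (lam a e)          = lam a (subst σ e)
    subst σ (app f es)         = app f (subst* σ es)
    subst σ (letrec as u es e) = letrec as u (subst* σ es) (subst σ e)
    subst σ (susp p X)         = ⟦ p ⟧ · σ X

    subst* : ∀ {V n} → (V → LRL) → Vec (Expr V) n → Vec LRL n
    subst* σ []       = []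
    subst* σ (e ∷ es) = subst σ e ∷ subst* σ es

  mutual
    -- All occurrences of variables, with multiplicity.
    vars : ∀ {V} → Expr V → List V
    vars (atom a)           = []
    vars (lam a e)          = vars e
    vars (app f es)         = vars* es
    vars (letrec as u es e) = vars* es ++ vars e
    vars (susp p X)         = X ∷ []

    vars* : ∀ {V n} → Vec (Expr V) n → List V
    vars* []       = []
    vars* (e ∷ es) = vars e ++ vars* es

  data _∈FA_ (a : 𝔸) : LRL → Set where
    atom : a ∈FA atom a
    lam  : ∀ {b e} → a ≢ b → a ∈FA e → a ∈FA lam b e
    app  : ∀ {f es} i → a ∈FA lookup es i → a ∈FA app f es
    rhs  : ∀ {n} {as : Vec 𝔸 n} .{u : Unique as} {es e} i →
           a ∉ᵛ as → a ∈FA lookup es i → a ∈FA letrec as u es e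
    body : ∀ {n} {as : Vec 𝔸 n} .{u : Unique as} {es e} →
           a ∉ᵛ as → a ∈FA e → a ∈FA letrec as u es e

  _#_ : 𝔸 → LRL → Set
  a # e = ¬ (a ∈FA e)

  -- In the letrec rule, ρ reorders the bindings of the right-hand side.
  data _∼_ : LRL → LRL → Set where
    atom   : ∀ {a} → atom a ∼ atom a
    app    : ∀ {f es es′} → (∀ i → lookup es i ∼ lookup es′ i) → app f es ∼ app f es′
    lam    : ∀ {a e e′} → e ∼ e′ → lam a e ∼ lam a e′
    lamα   : ∀ {a b e e′} → a # e′ → e ∼ swap a b · e′ → lam a e ∼ lam b e′
    letrec : ∀ {n} {as bs : Vec 𝔸 n} .{u : Unique as} .{v : Unique bs} {ss ts r r′}
             (ρ : Permutation′ n) (π : Perm) →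
             (∀ c → π ·ᵃ c ≢ c → c ∈ᵛ as ⊎ c ∈ᵛ bs) →
             (∀ i → π ·ᵃ lookup bs (ρ ⟨$⟩ʳ i) ≡ lookup as i) →
             (∀ i → lookup as i # letrec bs v ts r′) →
             r ∼ π · r′ →
             (∀ i → lookup ss i ∼ π · lookup ts (ρ ⟨$⟩ʳ i)) →
             letrec as u ss r ∼ letrec bs v ts r′

  data _⊑_ (s : LRL) : LRL → Set where
    here : s ⊑ s
    lam  : ∀ {a e} → s ⊑ e → s ⊑ lam a e
    app  : ∀ {f es} i → s ⊑ lookup es i → s ⊑ app f es
    rhs  : ∀ {n} {as : Vec 𝔸 n} .{u : Unique as} {es e} i →
           s ⊑ lookup es i → s ⊑ letrec as u es e
    body : ∀ {n} {as : Vec 𝔸 n} .{u : Unique as} {es e} →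
           s ⊑ e → s ⊑ letrec as u es e

  -- The subset g of the bindings is env_g, its complement env_ng.
  data ContainsGarbage (t : LRL) : Set where
    garbage : ∀ {n} {as : Vec 𝔸 n} .{u : Unique as} {es r} →
              letrec as u es r ⊑ t →
              (g : Subset n) → Nonempty g →
              (∀ {i j} → i ∈ˢ g → j ∉ˢ g → lookup as i # lookup es j) →
              (∀ {i} → i ∈ˢ g → lookup as i # r) →
              ContainsGarbage t

  GarbageFree : LRL → Set
  GarbageFree t = ¬ ContainsGarbage t

  -- Instances are encoded as follows: expressions are written in prefix notation over eight tokens,
  -- each of which is a three-bit block.

  data Token : Set where
    atom lam app letrec susp end : Token
    bit : Bool → Token

  bits : Token → List Bool
  bits atom        = false ∷ false ∷ false ∷ []
  bits lam         = false ∷ false ∷ true  ∷ []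
  bits app         = false ∷ true  ∷ false ∷ []
  bits letrec      = false ∷ true  ∷ true  ∷ []
  bits susp        = true  ∷ false ∷ false ∷ []
  bits end         = true  ∷ false ∷ true  ∷ []
  bits (bit false) = true  ∷ true  ∷ false ∷ []
  bits (bit true)  = true  ∷ true  ∷ true  ∷ []

  write : Name → List Token
  write w = List.map bit w ++ end ∷ []

  -- Bindings and swappings are written like abstractions and pairs of atoms
  -- respectively, and a list of them is closed by `end`.
  mutual
    tokens : ∀ {V} → (V → Name) → Expr V → List Token
    tokens ν (atom a)           = atom ∷ write a
    tokens ν (lam a e)          = lam ∷ write a ++ tokens ν e
    tokens ν (app f es)         = app ∷ write (name f) ++ tokens* ν es
    tokens ν (letrec as u es e) = letrec ∷ bindings ν as es ++ end ∷ tokens ν e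
    tokens ν (susp p X)         =
      susp ∷ concatMap (λ (a , b) → atom ∷ write a ++ atom ∷ write b) p
           ++ end ∷ write (ν X)

    tokens* : ∀ {V n} → (V → Name) → Vec (Expr V) n → List Token
    tokens* ν []       = []
    tokens* ν (e ∷ es) = tokens ν e ++ tokens* ν es

    bindings : ∀ {V n} → (V → Name) → Vec 𝔸 n → Vec (Expr V) n → List Token
    bindings ν []       []       = []
    bindings ν (a ∷ as) (e ∷ es) = lam ∷ write a ++ tokens ν e ++ bindings ν as es

  record MatchingInstance : Set where
    field
      s            : LRLX
      t            : LRL
      X            : Var
      once         : vars s ≡ X ∷ []
      garbage-free : GarbageFree t

  Matching : Problem
  Matching = record
    { Instance = MatchingInstance
    ; encode   = λ I → let open MatchingInstance I in
                   concatMap bits (tokens id s ++ tokens ⊥-elim t)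
    ; Yes      = λ I → let open MatchingInstance I in
                   ∃[ σ ] subst σ s ∼ t
    }

{-# OPTIONS --safe #-}

-- A graph on n vertices becomes a closed environment with one binding for each
-- pair (u , v) of vertices.  The binder of (u , u) stands for the vertex u, and
-- the right-hand side at (u , v) is f u v or f u u, according to adjacency.
-- The right-hand side f u u at (u , u) forces a matching of two such environments
-- to send diagonal binders to diagonal binders, and as the graphs have no loops,
-- it is then a graph isomorphism.  The variable is the body of the letrec in s and
-- imposes no condition; the body of the letrec in t lists all binders, so that t
-- has no garbage.
--
-- The reduction is computed by a structured program on four tapes, which is
-- compiled to a Turing machine.  Binders are spelled in unary, so the machine
-- can copy them from two counters that hold the current row and column.
module Submission where

open import Data.Bool.Base using (Bool; true; false; if_then_else_)
open import Data.Empty using (⊥-elim)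
open import Data.Fin.Base using (Fin; zero; suc; toℕ; combine; remQuot)
open import Data.Fin.Patterns using (0F; 1F; 2F; 3F)
open import Data.Fin.Permutation
  using (Permutation; Permutation′; permutation; _⟨$⟩ʳ_; _⟨$⟩ˡ_; inverseˡ; inverseʳ; ↔⇒≡)
open import Data.Fin.Properties
  using (toℕ-injective; any?; combine-remQuot; remQuot-combine; *↔×; +↔⊎; 1↔⊤)
open import Data.List.Base as List
  using (List; []; _∷_; _++_; _ʳ++_; length; replicate; concat; concatMap)
open import Data.List.Properties
  using (++-assoc; ++-identityʳ; ++-ʳ++; ʳ++-ʳ++; map-ʳ++; concatMap-++; length-++; length-map;
         length-replicate; length-tabulate; map-tabulate; tabulate-cong; ∷-injectiveʳ)
open import Data.List.Relation.Unary.All using (All; []; _∷_)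
import Data.List.Relation.Unary.All.Properties as All
open import Data.Maybe.Base using (Maybe; just; nothing; maybe′; is-just)
open import Data.Nat.Base using (_≤_)
open import Data.Nat.Base using (ℕ; zero; suc; _+_; _*_; _^_; _<_; z≤n; s≤s)
open import Data.Nat.Properties
  using (≤-refl; ≤-reflexive; ≤-trans; <⇒≤; m≤m+n; m≤n+m; m<m+n; m≤m*n; m≤n⇒m≤1+n; m^n≢0;
         +-assoc; +-comm; +-suc; +-identityʳ; +-mono-≤; +-monoˡ-≤; +-monoʳ-≤; +-mono-<-≤;
         *-distribʳ-+; *-mono-≤; *-monoˡ-≤; *-monoʳ-≤; ^-identityʳ; ^-monoˡ-≤; ^-monoʳ-≤;
         module ≤-Reasoning)
open import Data.Nat.Solver using (module +-*-Solver)
open import Data.Product.Base using (Σ-syntax; ∃-syntax; _×_; _,_; proj₁; proj₂)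
open import Data.Product.Function.NonDependent.Propositional using (_×-↔_)
open import Data.Sum.Base using (_⊎_; inj₁; inj₂)
open import Data.Sum.Function.Propositional using (_⊎-↔_)
open import Data.Unit.Base using (⊤; tt)
open import Data.Vec.Base as Vec using (Vec; []; _∷_; lookup)
open import Data.Vec.Membership.Propositional using () renaming (_∈_ to _∈ᵛ_)
open import Data.Vec.Membership.Propositional.Properties using (∈-lookup)
open import Data.Vec.Properties
  using (lookup-map; lookup∘tabulate; tabulate∘lookup; lookup-concat; map-id; toList-++)
open import Data.Vec.Relation.Unary.Unique.Propositional using (Unique)
import Data.Vec.Relation.Unary.Unique.Propositional.Properties as Unique
open import Function.Base using (id; const; _∘_)
open import Function.Bundles using (_↔_; mk↔ₛ′; mk⇔; module Inverse)
open import Function.Construct.Composition using (_↔-∘_)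
open import Function.Construct.Identity using (↔-id)
open import Function.Construct.Symmetry using (↔-sym)
open import Relation.Binary.PropositionalEquality
  using (_≡_; _≢_; refl; sym; trans; cong; cong₂; subst₂; module ≡-Reasoning)
  renaming (subst to transport)
open import Relation.Nullary using (¬_; Dec; yes; no)
open import Relation.Nullary.Negation using (contradiction)
open import Defs

-- Structured programs

-- Each right-hand side of a letrec needs a binder of its own, so the edges cannot simply be
-- attached to the binders of the vertices. A binder `(u , v)` off the diagonal occurs in no
-- right-hand side: it only carries its entry, and without the body of `t` it would be garbage.
-- Non-edges receive a binding too, so that the environment follows the adjacency matrix cell by
-- cell and the program never has to search. The price is that the off-diagonal non-edges of one row
-- are interchangeable; a matching determines positions only on the diagonal and on edges, and
-- adjacency has to be recovered from these alone.
--
-- The body of `t` may mention every binder because the variable can be instantiated with a renamed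
-- copy of that body, capture being allowed. All this needs one symbol `f` of arity at least two;
-- the arguments between the first and the last are filled with a fixed closed expression.
--
-- Unary names are affordable because the encoding of a graph already spells its order in unary:
-- there are quadratically many cells, each with a text of linear length, which gives a cubic time
-- bound.

data Prog (k : ℕ) : Set where
  op    : Fin k → (Cell → Cell) → Move → Prog k
  _⨾_   : Prog k → Prog k → Prog k
  cond  : Fin k → (Cell → Bool) → Prog k → Prog k → Prog k
  while : Fin k → (Cell → Bool) → Prog k → Prog k

infixr 5 _⨾_

perform : (Cell → Cell) → Move → Tape → Tape
perform w m t = act-tape (w (head t) , m) t

module _ {k : ℕ} where

  Tapes : Set
  Tapes = Vec Tape k

  -- Because of `slow`, the number is only an upper bound on the time. Thus both branches of a
  -- `cond` and all rounds of a loop can be given one uniform bound.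
  data Runs : Prog k → Tapes → ℕ → Tapes → Set where
    op   : ∀ {j w m ts} → Runs (op j w m) ts 1 (Vec.updateAt ts j (perform w m))
    _⨾_  : ∀ {P Q ts ts₁ ts₂ a b} → Runs P ts a ts₁ → Runs Q ts₁ b ts₂ → Runs (P ⨾ Q) ts (a + b) ts₂
    holds : ∀ {j p P Q ts ts₁ a} → p (head (lookup ts j)) ≡ true →
           Runs P ts a ts₁ → Runs (cond j p P Q) ts (suc a) ts₁
    fails : ∀ {j p P Q ts ts₁ a} → p (head (lookup ts j)) ≡ false →
           Runs Q ts a ts₁ → Runs (cond j p P Q) ts (suc a) ts₁
    done : ∀ {j p P ts} → p (head (lookup ts j)) ≡ false → Runs (while j p P) ts 1 ts
    loop : ∀ {j p P ts ts₁ ts₂ a b} → p (head (lookup ts j)) ≡ true →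
           Runs P ts a ts₁ → Runs (while j p P) ts₁ b ts₂ → Runs (while j p P) ts (suc (a + b)) ts₂
    slow : ∀ {P ts ts₁ a b} → a ≤ b → Runs P ts a ts₁ → Runs P ts b ts₁

  State : Prog k → Set
  State (op _ _ _)     = ⊤
  State (P ⨾ Q)        = State P ⊎ State Q
  State (cond _ _ P Q) = ⊤ ⊎ (State P ⊎ State Q)
  State (while _ _ P)  = ⊤ ⊎ State P

  initialState : ∀ P → State P
  initialState (op _ _ _)     = tt
  initialState (P ⨾ Q)        = inj₁ (initialState P)
  initialState (cond _ _ P Q) = inj₁ tt
  initialState (while _ _ P)  = inj₁ tt

  Heads Actions : Set
  Heads   = Vec Cell k
  Actions = Vec (Cell × Move) k

  idle : Heads → Actions
  idle = Vec.map (_, N)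

  -- The value `nothing` for the successor state means that the program has ended.
  transit : ∀ P → State P → Heads → Maybe (State P) × Actions
  transit (op j w m)     tt              h =
    nothing , Vec.updateAt (idle h) j (λ (c , _) → w c , m)
  transit (P ⨾ Q)        (inj₁ s)        h =
    just (maybe′ inj₁ (inj₂ (initialState Q)) (proj₁ (transit P s h))) , proj₂ (transit P s h)
  transit (P ⨾ Q)        (inj₂ s)        h =
    maybe′ (λ s′ → just (inj₂ s′)) nothing (proj₁ (transit Q s h)) , proj₂ (transit Q s h)
  transit (cond j p P Q) (inj₁ tt)       h =
    just (inj₂ (if p (lookup h j) then inj₁ (initialState P) else inj₂ (initialState Q))) , idle h
  transit (cond j p P Q) (inj₂ (inj₁ s)) h =
    maybe′ (λ s′ → just (inj₂ (inj₁ s′))) nothing (proj₁ (transit P s h)) , proj₂ (transit P s h)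
  transit (cond j p P Q) (inj₂ (inj₂ s)) h =
    maybe′ (λ s′ → just (inj₂ (inj₂ s′))) nothing (proj₁ (transit Q s h)) , proj₂ (transit Q s h)
  transit (while j p P)  (inj₁ tt)       h =
    (if p (lookup h j) then just (inj₂ (initialState P)) else nothing) , idle h
  transit (while j p P)  (inj₂ s)        h =
    just (maybe′ inj₂ (inj₁ tt) (proj₁ (transit P s h))) , proj₂ (transit P s h)

  heads : Tapes → Heads
  heads = Vec.map head

  after : ∀ P → State P → Tapes → Tapes
  after P s ts = Vec.zipWith act-tape (proj₂ (transit P s (heads ts))) ts

  data Exec (P : Prog k) : State P → Tapes → ℕ → Tapes → Set where
    last : ∀ {s ts ts₁} → proj₁ (transit P s (heads ts)) ≡ nothing → after P s ts ≡ ts₁ →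
           Exec P s ts 1 ts₁
    more : ∀ {s s′ ts ts₁ ts₂ n} → proj₁ (transit P s (heads ts)) ≡ just s′ → after P s ts ≡ ts₁ →
           Exec P s′ ts₁ n ts₂ → Exec P s ts (suc n) ts₂

lookup-heads : ∀ {k} (ts : Vec Tape k) j → lookup (Vec.map head ts) j ≡ head (lookup ts j)
lookup-heads (t ∷ ts) zero    = refl
lookup-heads (t ∷ ts) (suc j) = lookup-heads ts j

idle-acts : ∀ {k} (ts : Vec Tape k) → Vec.zipWith act-tape (idle (heads ts)) ts ≡ ts
idle-acts []       = refl
idle-acts (t ∷ ts) = cong (t ∷_) (idle-acts ts)

op-acts : ∀ {k} (ts : Vec Tape k) j w m →
  Vec.zipWith act-tape (Vec.updateAt (idle (heads ts)) j (λ (c , _) → w c , m)) ts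
  ≡ Vec.updateAt ts j (perform w m)
op-acts (t ∷ ts) zero    w m = cong (_ ∷_) (idle-acts ts)
op-acts (t ∷ ts) (suc j) w m = cong (_ ∷_) (op-acts ts j w m)

module _ {k : ℕ} where

  exec-⨾ʳ : ∀ {P Q : Prog k} {s ts n ts₁} → Exec Q s ts n ts₁ → Exec (P ⨾ Q) (inj₂ s) ts n ts₁
  exec-⨾ʳ (last e a)   = last (cong (maybe′ _ nothing) e) a
  exec-⨾ʳ (more e a r) = more (cong (maybe′ _ nothing) e) a (exec-⨾ʳ r)

  -- The step that ends `P` already enters the initial state of `Q`, so sequencing costs no extra
  -- step and the times add up exactly.
  exec-⨾ : ∀ {P Q : Prog k} {s ts m ts₁ n ts₂} →
    Exec P s ts m ts₁ → Exec Q (initialState Q) ts₁ n ts₂ → Exec (P ⨾ Q) (inj₁ s) ts (m + n) ts₂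
  exec-⨾ (last e a)   q = more (cong (λ x → just (maybe′ inj₁ _ x)) e) a (exec-⨾ʳ q)
  exec-⨾ (more e a r) q = more (cong (λ x → just (maybe′ inj₁ _ x)) e) a (exec-⨾ r q)

  exec-then : ∀ {j p} {P Q : Prog k} {s ts n ts₁} →
    Exec P s ts n ts₁ → Exec (cond j p P Q) (inj₂ (inj₁ s)) ts n ts₁
  exec-then (last e a)   = last (cong (maybe′ _ nothing) e) a
  exec-then (more e a r) = more (cong (maybe′ _ nothing) e) a (exec-then r)

  exec-else : ∀ {j p} {P Q : Prog k} {s ts n ts₁} →
    Exec Q s ts n ts₁ → Exec (cond j p P Q) (inj₂ (inj₂ s)) ts n ts₁
  exec-else (last e a)   = last (cong (maybe′ _ nothing) e) a
  exec-else (more e a r) = more (cong (maybe′ _ nothing) e) a (exec-else r)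

  exec-loop : ∀ {j p} {P : Prog k} {s ts m ts₁ n ts₂} →
    Exec P s ts m ts₁ → Exec (while j p P) (inj₁ tt) ts₁ n ts₂ →
    Exec (while j p P) (inj₂ s) ts (m + n) ts₂
  exec-loop (last e a)   q = more (cong (λ x → just (maybe′ inj₂ _ x)) e) a q
  exec-loop (more e a r) q = more (cong (λ x → just (maybe′ inj₂ _ x)) e) a (exec-loop r q)

  test : ∀ {A : Set} (ts : Vec Tape k) j (p : Cell → Bool) {b} {x y : A} → p (head (lookup ts j)) ≡ b →
    (if p (lookup (heads ts) j) then x else y) ≡ (if b then x else y)
  test ts j p e = cong (λ c → if c then _ else _) (trans (cong p (lookup-heads ts j)) e)

  run⇒exec : ∀ {P : Prog k} {ts n ts₁} → Runs P ts n ts₁ →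
             ∃[ m ] m ≤ n × Exec P (initialState P) ts m ts₁
  run⇒exec (op {j} {w} {m} {ts}) = 1 , ≤-refl , last refl (op-acts ts j w m)
  run⇒exec (r ⨾ q) with run⇒exec r | run⇒exec q
  ... | a , a≤ , x | b , b≤ , y = a + b , +-mono-≤ a≤ b≤ , exec-⨾ x y
  run⇒exec (holds {j} {p} {ts = ts} e r) with run⇒exec r
  ... | a , a≤ , x = suc a , s≤s a≤ ,
        more (cong (λ s → just (inj₂ s)) (test ts j p e)) (idle-acts ts) (exec-then x)
  run⇒exec (fails {j} {p} {ts = ts} e r) with run⇒exec r
  ... | a , a≤ , x = suc a , s≤s a≤ ,
        more (cong (λ s → just (inj₂ s)) (test ts j p e)) (idle-acts ts) (exec-else x)
  run⇒exec (done {j} {p} {ts = ts} e) = 1 , ≤-refl , last (test ts j p e) (idle-acts ts)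
  run⇒exec (loop {j} {p} {ts = ts} e r q) with run⇒exec r | run⇒exec q
  ... | a , a≤ , x | b , b≤ , y = suc (a + b) , s≤s (+-mono-≤ a≤ b≤) ,
        more (test ts j p e) (idle-acts ts) (exec-loop x y)
  run⇒exec (slow a≤b r) with run⇒exec r
  ... | a , a≤ , x = a , ≤-trans a≤ a≤b , x

  state-finite : ∀ (P : Prog k) → ∃[ q ] (State P ↔ Fin q)
  state-finite (op _ _ _)     = 1 , ↔-sym 1↔⊤
  state-finite (P ⨾ Q)        with state-finite P | state-finite Q
  ... | a , f | b , g = a + b , ↔-sym +↔⊎ ↔-∘ (f ⊎-↔ g)
  state-finite (cond _ _ P Q) with state-finite P | state-finite Q
  ... | a , f | b , g = 1 + (a + b) , ↔-sym +↔⊎ ↔-∘ (↔-sym 1↔⊤ ⊎-↔ (↔-sym +↔⊎ ↔-∘ (f ⊎-↔ g)))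
  state-finite (while _ _ P)  with state-finite P
  ... | a , f = 1 + a , ↔-sym +↔⊎ ↔-∘ (↔-sym 1↔⊤ ⊎-↔ f)

-- Turing machines from programs

maybe-finite : ∀ {A : Set} {q} → A ↔ Fin q → Maybe A ↔ Fin (suc q)
maybe-finite {A} {q} f = mk↔ₛ′ to from to∘from from∘to
  where
  to : Maybe A → Fin (suc q)
  to = maybe′ (λ a → suc (Inverse.to f a)) zero
  from : Fin (suc q) → Maybe A
  from zero    = nothing
  from (suc i) = just (Inverse.from f i)
  to∘from : ∀ i → to (from i) ≡ i
  to∘from zero    = refl
  to∘from (suc i) = cong suc (Inverse.strictlyInverseˡ f i)
  from∘to : ∀ a → from (to a) ≡ a
  from∘to nothing  = refl
  from∘to (just a) = cong just (Inverse.strictlyInverseʳ f a)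

-- The last step of a program still acts on the tapes, whereas a machine halts by having no
-- transition. Hence the additional state `nothing`, which the last step enters and in which `δ` is
-- undefined.
compile : ∀ {e} → Prog (2 + e) → TM
compile {e} P = record
  { extra  = e
  ; State  = Maybe (State P)
  ; finite = _ , maybe-finite (proj₂ (state-finite P))
  ; start  = just (initialState P)
  ; δ      = λ { nothing _ → nothing ; (just s) h → just (transit P s h) }
  }

module _ {e} (P : Prog (2 + e)) where
  open module CompiledRun = Run (compile P) using (_⇓[_]_; halt; next)

  exec⇒⇓ : ∀ {s ts n ts₁} → Exec P s ts n ts₁ → (just s , ts) ⇓[ n ] (nothing , ts₁)
  exec⇒⇓ (last e a)   = next (cong₂ (λ x y → just (x , y)) e a) (halt refl)
  exec⇒⇓ (more e a r) = next (cong₂ (λ x y → just (x , y)) e a) (exec⇒⇓ r)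

  run⇒⇓ : ∀ {ts n ts₁} → Runs P ts n ts₁ →
          ∃[ m ] m ≤ n × (just (initialState P) , ts) ⇓[ m ] (nothing , ts₁)
  run⇒⇓ r with run⇒exec r
  ... | m , m≤n , x = m , m≤n , exec⇒⇓ x

-- Head movement bounded by time

reach : ∀ {k} → Fin k → Vec Tape k → ℕ
reach i ts = length (Tape.left (lookup ts i))

length-left-move : ∀ m t → length (Tape.left (move m t)) ≤ suc (length (Tape.left t))
length-left-move L (tape []      _ _)       = z≤n
length-left-move L (tape (_ ∷ _) _ _)       = m≤n⇒m≤1+n (m≤n⇒m≤1+n ≤-refl)
length-left-move N t                        = m≤n⇒m≤1+n ≤-refl
length-left-move R (tape _ _ [])            = ≤-refl
length-left-move R (tape _ _ (_ ∷ _))       = ≤-refl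

reach-updateAt : ∀ {k} (i j : Fin k) w m ts →
  reach i (Vec.updateAt ts j (perform w m)) ≤ suc (reach i ts)
reach-updateAt zero    zero    w m (t ∷ ts) = length-left-move m _
reach-updateAt zero    (suc j) w m (t ∷ ts) = m≤n⇒m≤1+n ≤-refl
reach-updateAt (suc i) zero    w m (t ∷ ts) = m≤n⇒m≤1+n ≤-refl
reach-updateAt (suc i) (suc j) w m (t ∷ ts) = reach-updateAt i j w m ts

reach-trans : ∀ {x y z} a b → y ≤ a + x → z ≤ b + y → z ≤ a + b + x
reach-trans {x} {y} {z} a b p q = begin
  z            ≤⟨ q ⟩
  b + y        ≤⟨ +-monoʳ-≤ b p ⟩
  b + (a + x)  ≡⟨ +-assoc b a x ⟨
  b + a + x    ≡⟨ cong (_+ x) (+-comm b a) ⟩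
  a + b + x    ∎
  where open ≤-Reasoning

-- A step lists at most one more cell to the left of a head. On the output tape this bounds the
-- length of the written word by the time spent, so the cost of rewinding needs no separate count of
-- the symbols.
run-reach : ∀ {k} (i : Fin k) {P ts n ts₁} → Runs P ts n ts₁ → reach i ts₁ ≤ n + reach i ts
run-reach i (op {j} {w} {m} {ts})               = reach-updateAt i j w m ts
run-reach i (_⨾_ {a = a} {b = b} r q)           = reach-trans a b (run-reach i r) (run-reach i q)
run-reach i (holds e r)                         = m≤n⇒m≤1+n (run-reach i r)
run-reach i (fails e r)                         = m≤n⇒m≤1+n (run-reach i r)
run-reach i (done e)                            = m≤n⇒m≤1+n ≤-refl
run-reach i (loop {a = a} {b = b} e r q)        =
  m≤n⇒m≤1+n (reach-trans a b (run-reach i r) (run-reach i q))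
run-reach i (slow a≤b r)                        = ≤-trans (run-reach i r) (+-monoˡ-≤ _ a≤b)

-- Tape routines

-- `move` branches on whether the listed cells are exhausted. These functions absorb the branch, so
-- that loop invariants hold without a case split at the ends of the tape.
peekˡ peekʳ : List Cell → List Cell → Tape
peekˡ []       rs = tape [] nothing rs
peekˡ (l ∷ ls) rs = tape ls l rs
peekʳ ls []       = tape ls nothing []
peekʳ ls (r ∷ rs) = tape ls r rs

move-L : ∀ ls x rs → move L (tape ls x rs) ≡ peekˡ ls (x ∷ rs)
move-L []       x rs = refl
move-L (_ ∷ _)  x rs = refl

move-R : ∀ ls x rs → move R (tape ls x rs) ≡ peekʳ (x ∷ ls) rs
move-R ls x []      = refl
move-R ls x (_ ∷ _) = refl

isOne isZero : Cell → Bool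
isOne (just true)   = true
isOne _             = false
isZero (just false) = true
isZero _            = false

replicate-∷ : ∀ {A : Set} n (x : A) xs → replicate n x ++ x ∷ xs ≡ x ∷ replicate n x ++ xs
replicate-∷ zero    x xs = refl
replicate-∷ (suc n) x xs = cong (x ∷_) (replicate-∷ n x xs)

land : ∀ {k} {P : Prog k} {ts n ts₁ ts₂} → ts₁ ≡ ts₂ → Runs P ts n ts₁ → Runs P ts n ts₂
land refl r = r

depart : ∀ {k} {P : Prog k} {ts n ts₁ ts₂} → ts₁ ≡ ts₂ → Runs P ts₂ n ts → Runs P ts₁ n ts
depart refl r = r

bound : ∀ {k} {P : Prog k} {ts a b ts₁} → a ≡ b → Runs P ts a ts₁ → Runs P ts b ts₁
bound refl r = r

-- Tapes 0 and 1 are the input and the output, tapes 2 and 3 hold the row and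
-- the column of the current matrix entry.
data Counter : Set where
  row col : Counter

index : Counter → Fin 4
index row = 2F
index col = 3F

pair : Counter → Tape → Tape → Vec Tape 2
pair row t t′ = t ∷ t′ ∷ []
pair col t t′ = t′ ∷ t ∷ []

written : List Bool → Tape
written acc = tape (List.map just acc) nothing []

reading : List Cell → List Bool → Tape
reading ls bs = peekʳ ls (List.map just bs)

-- A counter with value u is a block of u ones to the left of the head.
ones : ℕ → List Cell → List Cell
ones u ls = replicate u (just true) ++ nothing ∷ ls

-- The `r` zeros are the values still to come. The listed blank behind them is the cell from which
-- `reset` stepped back, so that for `r = 0` this is literally `tape (ones u ls) nothing []`.
counter : ℕ → ℕ → List Cell → Tape
counter u r ls = peekʳ (ones u ls) (replicate r (just false) ++ nothing ∷ [])

module _ {i o t′ : Tape} where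

  op-counter : ∀ c {w m t} →
    Runs (op (index c) w m) (i ∷ o ∷ pair c t t′) 1 (i ∷ o ∷ pair c (perform w m t) t′)
  op-counter row = op
  op-counter col = op

  left-counter : ∀ c {w ls x rs} →
    Runs (op (index c) w L) (i ∷ o ∷ pair c (tape ls x rs) t′) 1
         (i ∷ o ∷ pair c (peekˡ ls (w x ∷ rs)) t′)
  left-counter c {w} {ls} {x} {rs} =
    land (cong (λ t → i ∷ o ∷ pair c t t′) (move-L ls (w x) rs)) (op-counter c)

  right-counter : ∀ c {w ls x rs} →
    Runs (op (index c) w R) (i ∷ o ∷ pair c (tape ls x rs) t′) 1
         (i ∷ o ∷ pair c (peekʳ (w x ∷ ls) rs) t′)
  right-counter c {w} {ls} {x} {rs} =
    land (cong (λ t → i ∷ o ∷ pair c t t′) (move-R ls (w x) rs)) (op-counter c)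

  head-counter : ∀ c {t} (p : Cell → Bool) →
    p (head (lookup (i ∷ o ∷ pair c t t′) (index c))) ≡ p (head t)
  head-counter row p = refl
  head-counter col p = refl

right-input : ∀ {ls b bs} {r : Vec Tape 3} →
  Runs (op 0F id R) (reading ls (b ∷ bs) ∷ r) 1 (reading (just b ∷ ls) bs ∷ r)
right-input {ls} {b} {bs} {r} = land (cong (_∷ r) (move-R ls (just b) (List.map just bs))) op

-- There is no empty program; `op 1F id N` is an idle step, and it accounts for the `suc` in the
-- time of `emit`.
emit : List Bool → Prog 4
emit []       = op 1F id N
emit (b ∷ bs) = op 1F (const (just b)) R ⨾ emit bs

emit-runs : ∀ bs {i acc r} →
  Runs (emit bs) (i ∷ written acc ∷ r) (suc (length bs)) (i ∷ written (bs ʳ++ acc) ∷ r)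
emit-runs []       = op
emit-runs (b ∷ bs) = op ⨾ emit-runs bs

skipOnes : Counter → Prog 4
skipOnes c = while (index c) isOne (op (index c) id R)

skipOnes-runs : ∀ c u {i o t′ ls rs} →
  Runs (skipOnes c) (i ∷ o ∷ pair c (peekʳ ls (replicate u (just true) ++ just false ∷ rs)) t′)
       (u * 2 + 1) (i ∷ o ∷ pair c (tape (replicate u (just true) ++ ls) (just false) rs) t′)
skipOnes-runs c zero    = done (head-counter c isOne)
skipOnes-runs c (suc u) {i} {o} {t′} {ls} {rs} =
  land (cong (λ x → i ∷ o ∷ pair c (tape x (just false) rs) t′) (replicate-∷ u (just true) ls))
    (loop (head-counter c isOne) (right-counter c) (skipOnes-runs c u))

-- The loop stops at the blank that `ones` puts below the block, so whatever lies further left, such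
-- as the counter of an earlier graph, stays intact.
reset : Counter → Prog 4
reset c = op (index c) id L ⨾ while (index c) is-just (op (index c) (const (just false)) L)
        ⨾ op (index c) id R

reset-runs : ∀ c n {i o t′ ls} →
  Runs (reset c) (i ∷ o ∷ pair c (tape (ones n ls) nothing []) t′)
       (n * 2 + 3) (i ∷ o ∷ pair c (counter 0 n ls) t′)
reset-runs c n {i} {o} {t′} {ls} =
  bound (solve 1 (λ n → con 1 :+ (n :* con 2 :+ con 1 :+ con 1) := n :* con 2 :+ con 3) refl n)
    (left-counter c ⨾ back n ⨾ right-counter c)
  where
  open +-*-Solver
  back : ∀ u {rs} →
    Runs (while (index c) is-just (op (index c) (const (just false)) L))
         (i ∷ o ∷ pair c (peekˡ (ones u ls) rs) t′) (u * 2 + 1)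
         (i ∷ o ∷ pair c (tape ls nothing (replicate u (just false) ++ rs)) t′)
  back zero         = done (head-counter c is-just)
  back (suc u) {rs} =
    land (cong (λ x → i ∷ o ∷ pair c (tape ls nothing x) t′) (replicate-∷ u (just false) rs))
      (loop (head-counter c is-just) (left-counter c) (back u))

readOrder : Prog 4
readOrder =
  while 0F isOne
    (op 2F (const (just true)) R ⨾ op 3F (const (just true)) R ⨾ op 0F id R)
  ⨾ op 0F id R

readOrder-runs : ∀ n {ls rest o cu cv} →
  Runs readOrder
    (reading ls (replicate n true ++ false ∷ rest) ∷ o ∷ tape cu nothing [] ∷ tape cv nothing [] ∷ [])
    (n * 4 + 2)
    (reading (just false ∷ replicate n (just true) ++ ls) rest ∷ o ∷
     tape (replicate n (just true) ++ cu) nothing [] ∷ tape (replicate n (just true) ++ cv) nothing [] ∷ [])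
readOrder-runs n {rest = rest} {o} = bound (+-assoc (n * 4) 1 1) (go n ⨾ right-input)
  where
  go : ∀ n {ls cu cv} →
    Runs (while 0F isOne
           (op 2F (const (just true)) R ⨾ op 3F (const (just true)) R ⨾ op 0F id R))
      (reading ls (replicate n true ++ false ∷ rest) ∷ o ∷ tape cu nothing [] ∷ tape cv nothing [] ∷ [])
      (n * 4 + 1)
      (reading (replicate n (just true) ++ ls) (false ∷ rest) ∷ o ∷
       tape (replicate n (just true) ++ cu) nothing [] ∷ tape (replicate n (just true) ++ cv) nothing [] ∷ [])
  go zero = done refl
  go (suc n) {ls} {cu} {cv}
    rewrite sym (replicate-∷ n (just true) ls) | sym (replicate-∷ n (just true) cu)
          | sym (replicate-∷ n (just true) cv)
    = loop refl (op ⨾ op ⨾ right-input) (go n)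

-- The output is read from the head to the right, but printing leaves the head behind the word. As
-- the word contains no blank, the first blank to the left marks its beginning.
rewind : Prog 4
rewind = op 1F id L ⨾ while 1F is-just (op 1F id L) ⨾ op 1F id R

rewind-runs : ∀ acc {i r} →
  Runs rewind (i ∷ written acc ∷ r) (length acc * 2 + 3)
       (i ∷ peekʳ (nothing ∷ []) (List.map just acc ʳ++ nothing ∷ []) ∷ r)
rewind-runs acc {i} {r} =
  bound (solve 1 (λ n → con 1 :+ (n :* con 2 :+ con 1 :+ con 1) := n :* con 2 :+ con 3) refl (length acc))
    (land (cong (λ t → i ∷ t ∷ r) (move-L (List.map just acc) nothing [])) op
     ⨾ back acc ⨾ land (cong (λ t → i ∷ t ∷ r) (move-R [] nothing _)) op)
  where
  open +-*-Solver
  back : ∀ acc {rs} →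
    Runs (while 1F is-just (op 1F id L)) (i ∷ peekˡ (List.map just acc) rs ∷ r) (length acc * 2 + 1)
         (i ∷ tape [] nothing (List.map just acc ʳ++ rs) ∷ r)
  back []        = done refl
  back (b ∷ acc) = loop refl (land (cong (λ t → i ∷ t ∷ r) (move-L (List.map just acc) (just b) _)) op) (back acc)

unload-peekʳ : ∀ w ls → unload (peekʳ ls (List.map just w ++ nothing ∷ [])) ≡ w
unload-peekʳ []      ls = refl
unload-peekʳ (b ∷ w) ls = start ls (just b) _ (b ∷ w) refl
  where
  scan : ∀ (g : List Cell → List Bool) → (∀ cs → g (nothing ∷ cs) ≡ []) →
         (∀ b cs → g (just b ∷ cs) ≡ b ∷ g cs) → ∀ w cs → cs ≡ List.map just w ++ nothing ∷ [] → g cs ≡ w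
  scan g g[] g∷ []      _ refl = g[] _
  scan g g[] g∷ (b ∷ w) _ refl = trans (g∷ b _) (cong (b ∷_) (scan g g[] g∷ w _ refl))
  -- Abstracting x ∷ rs lets the local function of unload be inferred as g.
  start : ∀ ls x rs w → x ∷ rs ≡ List.map just w ++ nothing ∷ [] → unload (tape ls x rs) ≡ w
  start ls x rs = abstracted
    where
    mutual
      g : List Cell → List Bool
      g = _
      abstracted : ∀ w → x ∷ rs ≡ List.map just w ++ nothing ∷ [] → unload (tape ls x rs) ≡ w
      abstracted w eq with x ∷ rs
      ... | cs = scan g (λ _ → refl) (λ _ _ → refl) w cs eq

-- Printing the text of one matrix cell

module Print (digit : List Bool) where

  data Piece : Set where
    word  : List Bool → Piece
    unary : Counter → Piece

  value : ℕ → ℕ → Counter → ℕ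
  value u v row = u
  value u v col = v

  spell : ℕ → ℕ → Piece → List Bool
  spell u v (word w)  = w
  spell u v (unary c) = concat (replicate (value u v c) digit)

  -- The counter is traversed backwards, which is harmless since all digits are equal. `skipOnes`
  -- then brings the head back to the zero from which it started.
  emitUnary : Counter → Prog 4
  emitUnary c = op (index c) id L ⨾ while (index c) isOne (emit digit ⨾ op (index c) id L)
              ⨾ op (index c) id R ⨾ skipOnes c

  emitUnary-runs : ∀ c u {i acc t′ ls rs} →
    Runs (emitUnary c) (i ∷ written acc ∷ pair c (tape (ones u ls) (just false) rs) t′)
         ((5 + length digit) * suc u)
         (i ∷ written (concat (replicate u digit) ʳ++ acc) ∷ pair c (tape (ones u ls) (just false) rs) t′)
  emitUnary-runs c u {i} {acc} {t′} {ls} {rs} =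
    -- With `d = length digit` the exact time is `u * (d + 5) + 4`; the slack `suc d` rounds it up
    -- to a multiple of `suc u`.
    slow (≤-trans (m≤m+n _ (suc (length digit))) (≤-reflexive
      (solve 2 (λ u d → con 1 :+ (u :* (d :+ con 3) :+ con 1 :+ (con 1 :+ (u :* con 2 :+ con 1)))
                        :+ (con 1 :+ d) := (con 5 :+ d) :* (con 1 :+ u)) refl u (length digit))))
      (left-counter c ⨾ back u ⨾ right-counter c ⨾ skipOnes-runs c u)
    where
    open +-*-Solver
    back : ∀ u {acc rs} →
      Runs (while (index c) isOne (emit digit ⨾ op (index c) id L))
           (i ∷ written acc ∷ pair c (peekˡ (ones u ls) rs) t′) (u * (length digit + 3) + 1)
           (i ∷ written (concat (replicate u digit) ʳ++ acc) ∷
            pair c (tape ls nothing (replicate u (just true) ++ rs)) t′)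
    back zero = done (head-counter c isOne)
    back (suc u) {acc} {rs} =
      land (cong₂ (λ x y → i ∷ written x ∷ pair c (tape ls nothing y) t′)
             (sym (++-ʳ++ digit)) (replicate-∷ u (just true) rs))
      (bound (solve 2 (λ d u → con 1 :+ (con 1 :+ d :+ con 1 :+ (u :* (d :+ con 3) :+ con 1))
                        := d :+ con 3 :+ u :* (d :+ con 3) :+ con 1) refl (length digit) u)
        (loop (head-counter c isOne) (emit-runs digit ⨾ left-counter c) (back u)))

  print : List Piece → Prog 4
  print []             = op 1F id N
  print (word w ∷ ps)  = emit w ⨾ print ps
  print (unary c ∷ ps) = emitUnary c ⨾ print ps

  -- This is the coefficient of `suc l` in the printing time when both counters are at most `l`. The
  -- final 1 pays for the idle step of `print []`.
  weight : List Piece → ℕ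
  weight []             = 1
  weight (word w ∷ ps)  = suc (length w) + weight ps
  weight (unary c ∷ ps) = 5 + length digit + weight ps

  module _ {l u v : ℕ} (u≤l : u ≤ l) (v≤l : v ≤ l) {cu cv rsu rsv : List Cell} where

    private
      at : Tape → List Bool → Vec Tape 4
      at i acc = i ∷ written acc ∷ tape (ones u cu) (just false) rsu
                                 ∷ tape (ones v cv) (just false) rsv ∷ []

    unary-runs : ∀ c {i acc} →
      Runs (emitUnary c) (at i acc) ((5 + length digit) * suc l) (at i (spell u v (unary c) ʳ++ acc))
    unary-runs row = slow (*-monoʳ-≤ (5 + length digit) (s≤s u≤l)) (emitUnary-runs row u)
    unary-runs col = slow (*-monoʳ-≤ (5 + length digit) (s≤s v≤l)) (emitUnary-runs col v)

    print-runs : ∀ ps {i acc} →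
      Runs (print ps) (at i acc) (weight ps * suc l) (at i (concatMap (spell u v) ps ʳ++ acc))
    print-runs []                  = slow (s≤s z≤n) op
    print-runs (word w ∷ ps) {i}   =
      land (cong (at i) (sym (++-ʳ++ w)))
        (bound (sym (*-distribʳ-+ (suc l) (suc (length w)) (weight ps)))
          (slow (m≤m*n (suc (length w)) (suc l)) (emit-runs w) ⨾ print-runs ps))
    print-runs (unary c ∷ ps) {i}  =
      land (cong (at i) (sym (++-ʳ++ (spell u v (unary c)))))
        (bound (sym (*-distribʳ-+ (suc l) (5 + length digit) (weight ps)))
          (unary-runs c ⨾ print-runs ps))

-- The translating program

-- A zero under the head of a counter means that a row or column is still to come, and overwriting
-- it with a one advances the counter. Both counters stand behind their block before and after
-- `grid`, so that `grid` can be run again with the same order.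
rowLoop grid : Prog 4 → Prog 4
rowLoop cell = while 3F isZero (cell ⨾ op 3F (const (just true)) R)
grid cell =
  reset row ⨾ while 2F isZero (reset col ⨾ rowLoop cell ⨾ op 2F (const (just true)) R)

rowText : (ℕ → ℕ → Bool → List Bool) → ℕ → ℕ → List Bool → List Bool
rowText text u v []       = []
rowText text u v (b ∷ bs) = text u v b ++ rowText text u (suc v) bs

gridText : (ℕ → ℕ → Bool → List Bool) → ℕ → List (List Bool) → List Bool
gridText text u []         = []
gridText text u (bs ∷ bss) = rowText text u 0 bs ++ gridText text (suc u) bss

length-pos : ∀ {m r n} → m + suc r ≡ n → m < n
length-pos {m} {r} refl = ≤-trans (m≤m+n (suc m) r) (≤-reflexive (sym (+-suc m r)))

-- `Input bs t` says that the entries bs are still to be processed when the input tape is t.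
module _ {cell : Prog 4} {B n : ℕ} {Input : List Bool → Tape → Set} {text : ℕ → ℕ → Bool → List Bool}
  (cell-runs : ∀ {b bs t acc u v cu cv rsu rsv} → u < n → v < n → Input (b ∷ bs) t →
    ∃[ t₁ ] Input bs t₁ ×
      Runs cell
        (t ∷ written acc ∷ tape (ones u cu) (just false) rsu ∷ tape (ones v cv) (just false) rsv ∷ [])
        B
        (t₁ ∷ written (text u v b ʳ++ acc)
            ∷ tape (ones u cu) (just false) rsu ∷ tape (ones v cv) (just false) rsv ∷ []))
  where

  rowLoop-runs : ∀ bs {rest t acc u v cu cv rsu} → u < n → v + length bs ≡ n → Input (bs ++ rest) t →
    ∃[ t₁ ] Input rest t₁ ×
      Runs (rowLoop cell)
        (t ∷ written acc ∷ tape (ones u cu) (just false) rsu ∷ counter v (length bs) cv ∷ [])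
        (length bs * (B + 2) + 1)
        (t₁ ∷ written (rowText text u v bs ʳ++ acc)
            ∷ tape (ones u cu) (just false) rsu ∷ tape (ones n cv) nothing [] ∷ [])
  rowLoop-runs [] {t = t} {acc} {u} {v} {cu} {cv} {rsu} u<n eq inp = t , inp ,
    land (cong (λ x → t ∷ written acc ∷ tape (ones u cu) (just false) rsu ∷ tape (ones x cv) nothing [] ∷ [])
           (trans (sym (+-identityʳ v)) eq))
      (done refl)
  rowLoop-runs (b ∷ bs) {acc = acc} {u} {v} {cu} {cv} {rsu} u<n eq inp
    with cell-runs u<n (length-pos eq) inp
  ... | t₁ , inp₁ , r
    with rowLoop-runs bs {acc = text u v b ʳ++ acc} {v = suc v} {cu} {cv} {rsu} u<n
           (trans (sym (+-suc v (length bs))) eq) inp₁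
  ... | t₂ , inp₂ , q = t₂ , inp₂ ,
    bound (solve 2 (λ B m → con 1 :+ (B :+ con 1 :+ (m :* (B :+ con 2) :+ con 1))
             := B :+ con 2 :+ m :* (B :+ con 2) :+ con 1) refl B (length bs))
      (land (cong (λ x → t₂ ∷ written x ∷ tape (ones u cu) (just false) rsu ∷ tape (ones n cv) nothing [] ∷ [])
               (sym (++-ʳ++ (text u v b))))
        (loop refl (r ⨾ right-counter col) q))
    where open +-*-Solver

  -- One row costs 1 for the test, `n * 2 + 3` for resetting the column, `n * (B + 2) + 1` for the
  -- row loop and 1 for advancing the row counter. In `gridCost` the row counter is reset once, and
  -- the last 1 is the failing test.
  rowCost gridCost : ℕ
  rowCost  = n * (B + 2) + 2 * n + 6
  gridCost = n * 2 + 3 + (n * rowCost + 1)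

  rows-runs : ∀ bss {rest t acc u cu cv} → All (λ bs → length bs ≡ n) bss → u + length bss ≡ n →
    Input (concat bss ++ rest) t →
    ∃[ t₁ ] Input rest t₁ ×
      Runs (while 2F isZero (reset col ⨾ rowLoop cell ⨾ op 2F (const (just true)) R))
        (t ∷ written acc ∷ counter u (length bss) cu ∷ tape (ones n cv) nothing [] ∷ [])
        (length bss * rowCost + 1)
        (t₁ ∷ written (gridText text u bss ʳ++ acc)
            ∷ tape (ones n cu) nothing [] ∷ tape (ones n cv) nothing [] ∷ [])
  rows-runs [] {t = t} {acc} {u} {cu} {cv} [] eq inp = t , inp ,
    land (cong (λ x → t ∷ written acc ∷ tape (ones x cu) nothing [] ∷ tape (ones n cv) nothing [] ∷ [])
           (trans (sym (+-identityʳ u)) eq))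
      (done refl)
  rows-runs (bs ∷ bss) {rest} {t} {acc} {u} {cu} {cv} (refl ∷ ps) eq inp
    with rowLoop-runs bs {concat bss ++ rest} {t} {acc} {u} {0} {cu} {cv}
           {replicate (length bss) (just false) ++ nothing ∷ []} (length-pos eq) refl
           (transport (λ x → Input x t) (++-assoc bs (concat bss) rest) inp)
  ... | t₁ , inp₁ , r
    with rows-runs bss {rest} {t₁} {rowText text u 0 bs ʳ++ acc} {suc u} {cu} {cv} ps
           (trans (sym (+-suc u (length bss))) eq) inp₁
  ... | t₂ , inp₂ , q = t₂ , inp₂ ,
    bound (solve 3 (λ B m n →
             con 1 :+ (n :* con 2 :+ con 3 :+ (n :* (B :+ con 2) :+ con 1 :+ con 1)
               :+ (m :* (n :* (B :+ con 2) :+ con 2 :* n :+ con 6) :+ con 1))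
             := n :* (B :+ con 2) :+ con 2 :* n :+ con 6
               :+ m :* (n :* (B :+ con 2) :+ con 2 :* n :+ con 6) :+ con 1)
             refl B (length bss) (length bs))
      (land (cong (λ x → t₂ ∷ written x ∷ tape (ones n cu) nothing [] ∷ tape (ones n cv) nothing [] ∷ [])
               (sym (++-ʳ++ (rowText text u 0 bs))))
        (loop refl (reset-runs col n ⨾ r ⨾ right-counter row) q))
    where open +-*-Solver

  grid-runs : ∀ bss {rest t acc cu cv} → All (λ bs → length bs ≡ n) bss → length bss ≡ n →
    Input (concat bss ++ rest) t →
    ∃[ t₁ ] Input rest t₁ ×
      Runs (grid cell)
        (t ∷ written acc ∷ tape (ones n cu) nothing [] ∷ tape (ones n cv) nothing [] ∷ [])
        gridCost
        (t₁ ∷ written (gridText text 0 bss ʳ++ acc)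
            ∷ tape (ones n cu) nothing [] ∷ tape (ones n cv) nothing [] ∷ [])
  grid-runs bss {rest} {t} {acc} {cu} {cv} ps refl inp
    with rows-runs bss {rest} {t} {acc} {0} {cu} {cv} ps refl inp
  ... | t₁ , inp₁ , r = t₁ , inp₁ , reset-runs row n ⨾ r

-- There are `n * n` cells of cost `K * suc l` each, which is the origin of the exponent 3. All
-- terms without `K` add up to exactly `4 * suc n ^ 2`.
gridCost-bound : ∀ K {n l} → n ≤ l →
  n * 2 + 3 + (n * (n * (K * suc l + 2) + 2 * n + 6) + 1) ≤ (K + 4) * suc l ^ 3
gridCost-bound K {n} {l} n≤l = begin
  n * 2 + 3 + (n * (n * (K * suc l + 2) + 2 * n + 6) + 1)
    ≡⟨ solve 3 (λ K n l →
         n :* con 2 :+ con 3 :+ (n :* (n :* (K :* l :+ con 2) :+ con 2 :* n :+ con 6) :+ con 1)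
         := K :* (n :* (n :* l)) :+ con 4 :* ((con 1 :+ n) :* ((con 1 :+ n) :* con 1)))
         refl K n (suc l) ⟩
  K * (n * (n * suc l)) + 4 * (suc n * (suc n * 1))
    ≤⟨ +-mono-≤ (*-monoʳ-≤ K (*-mono-≤ n≤ (*-monoˡ-≤ (suc l) n≤)))
                (*-monoʳ-≤ 4 (*-mono-≤ (s≤s n≤l) (*-mono-≤ (s≤s n≤l) (s≤s z≤n)))) ⟩
  K * (suc l * (suc l * suc l)) + 4 * (suc l * (suc l * suc l))
    ≡⟨ solve 2 (λ K l → K :* (l :* (l :* l)) :+ con 4 :* (l :* (l :* l))
                        := (K :+ con 4) :* (l :* (l :* (l :* con 1)))) refl K (suc l) ⟩
  (K + 4) * suc l ^ 3 ∎
  where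
  open +-*-Solver
  open ≤-Reasoning
  n≤ : n ≤ suc l
  n≤ = m≤n⇒m≤1+n n≤l

const-bound : ∀ c l → c ≤ c * suc l ^ 3
const-bound c l = m≤m*n c (suc l ^ 3) {{m^n≢0 (suc l) 3}}

linear-bound : ∀ {n l} → n ≤ l → 1 + (1 + (n * 4 + 2)) ≤ 4 * suc l ^ 3
linear-bound {n} {l} n≤l = begin
  1 + (1 + (n * 4 + 2))
    ≡⟨ solve 1 (λ n → con 1 :+ (con 1 :+ (n :* con 4 :+ con 2)) := con 4 :* (con 1 :+ n)) refl n ⟩
  4 * suc n        ≤⟨ *-monoʳ-≤ 4 (s≤s n≤l) ⟩
  4 * suc l        ≡⟨ cong (4 *_) (^-identityʳ (suc l)) ⟨
  4 * suc l ^ 1    ≤⟨ *-monoʳ-≤ 4 (^-monoʳ-≤ (suc l) {1} {3} (s≤s z≤n)) ⟩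
  4 * suc l ^ 3    ∎
  where
  open +-*-Solver
  open ≤-Reasoning

sequel : ∀ {k} {P Q : Prog k} {ts ts₁ ts₂} a b X →
  Runs P ts (a * X) ts₁ → Runs Q ts₁ (b * X) ts₂ → Runs (P ⨾ Q) ts ((a + b) * X) ts₂
sequel a b X r q = bound (sym (*-distribʳ-+ X a b)) (r ⨾ q)

load-reading : ∀ w → load w ≡ reading [] w
load-reading []      = refl
load-reading (_ ∷ _) = refl

matrixWord : List (List Bool) → List Bool
matrixWord bss = replicate (length bss) true ++ false ∷ concat bss

module Reduction (digit : List Bool) where
  open Print digit

  -- The two piece lists describe the text of an entry 1 and of an entry 0.
  entryText : List Piece → List Piece → ℕ → ℕ → Bool → List Bool
  entryText ps qs u v b = concatMap (spell u v) (if b then ps else qs)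

  readEntry : List Piece → List Piece → Prog 4
  readEntry ps qs = cond 0F isOne (print ps) (print qs) ⨾ op 0F id R

  entryWeight : List Piece → List Piece → ℕ
  entryWeight ps qs = 2 + (weight ps + weight qs)

  Rest : List Bool → List Bool → Tape → Set
  Rest rest bs t = ∃[ ls ] t ≡ reading ls (bs ++ rest)

  readEntry-runs : ∀ ps qs {rest l b bs t acc u v cu cv rsu rsv} → u ≤ l → v ≤ l → Rest rest (b ∷ bs) t →
    ∃[ t₁ ] Rest rest bs t₁ ×
      Runs (readEntry ps qs)
        (t ∷ written acc ∷ tape (ones u cu) (just false) rsu ∷ tape (ones v cv) (just false) rsv ∷ [])
        (entryWeight ps qs * suc l)
        (t₁ ∷ written (entryText ps qs u v b ʳ++ acc)
            ∷ tape (ones u cu) (just false) rsu ∷ tape (ones v cv) (just false) rsv ∷ [])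
  readEntry-runs ps qs {l = l} {b} u≤l v≤l (ls , refl) = _ , (just b ∷ ls , refl) ,
    slow cost (choose b ⨾ right-input)
    where
    open ≤-Reasoning
    cost : suc ((weight ps + weight qs) * suc l) + 1 ≤ entryWeight ps qs * suc l
    cost = begin
      suc ((weight ps + weight qs) * suc l) + 1   ≡⟨ cong suc (+-comm _ 1) ⟩
      2 + (weight ps + weight qs) * suc l         ≤⟨ +-monoˡ-≤ _ (m≤m*n 2 (suc l)) ⟩
      2 * suc l + (weight ps + weight qs) * suc l ≡⟨ *-distribʳ-+ (suc l) 2 (weight ps + weight qs) ⟨
      entryWeight ps qs * suc l                   ∎
    choose : ∀ b {ls bs acc cu cv rsu rsv} →
      Runs (cond 0F isOne (print ps) (print qs))
        (reading ls (b ∷ bs) ∷ written acc ∷ tape (ones _ cu) (just false) rsu ∷ tape (ones _ cv) (just false) rsv ∷ [])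
        (suc ((weight ps + weight qs) * suc l))
        (reading ls (b ∷ bs) ∷ written (entryText ps qs _ _ b ʳ++ acc)
            ∷ tape (ones _ cu) (just false) rsu ∷ tape (ones _ cv) (just false) rsv ∷ [])
    choose true  = holds refl (slow (*-monoˡ-≤ (suc l) (m≤m+n (weight ps) (weight qs))) (print-runs u≤l v≤l ps))
    choose false = fails refl (slow (*-monoˡ-≤ (suc l) (m≤n+m (weight qs) (weight ps))) (print-runs u≤l v≤l qs))

  copyText : List Piece → ℕ → ℕ → Bool → List Bool
  copyText ps u v _ = concatMap (spell u v) ps

  -- The two steps to the right leave a blank as the lower end of the new counters. Those of the
  -- preceding graph remain below it and are never visited again.
  enter : Prog 4
  enter = op 2F id R ⨾ op 3F id R ⨾ readOrder

  module _ (intro : List Bool) (ps qs : List Piece) where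

    convert : List Bool → Prog 4
    convert end = enter ⨾ emit intro ⨾ grid (readEntry ps qs) ⨾ emit end

    convertCost : List Bool → ℕ
    convertCost end = 4 + (suc (length intro) + (entryWeight ps qs + 4 + suc (length end)))

    convert-runs : ∀ end bss {rest l acc ls cu cv} → length bss ≤ l →
      All (λ bs → length bs ≡ length bss) bss →
      ∃[ ls₁ ] Runs (convert end)
        (reading ls (matrixWord bss ++ rest) ∷ written acc ∷ tape cu nothing [] ∷ tape cv nothing [] ∷ [])
        (convertCost end * suc l ^ 3)
        (reading ls₁ rest
          ∷ written (end ʳ++ (gridText (entryText ps qs) 0 bss ʳ++ (intro ʳ++ acc)))
          ∷ tape (ones (length bss) cu) nothing [] ∷ tape (ones (length bss) cv) nothing [] ∷ [])
    convert-runs end bss {rest} {l} {acc} {ls} {cu} {cv} n≤l al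
      with grid-runs {Input = Rest rest} {text = entryText ps qs}
             (λ {b} {bs} u<n v<n → readEntry-runs ps qs {rest} {l} {b} {bs} (≤-trans (<⇒≤ u<n) n≤l) (≤-trans (<⇒≤ v<n) n≤l))
             bss {[]} {reading _ (concat bss ++ rest)} {intro ʳ++ acc} {cu} {cv} al refl
             (just false ∷ replicate (length bss) (just true) ++ ls ,
              cong (λ x → reading (just false ∷ replicate (length bss) (just true) ++ ls) (x ++ rest)) (sym (++-identityʳ (concat bss))))

    ... | _ , (ls₁ , refl) , r = ls₁ ,
      sequel 4 (suc (length intro) + (entryWeight ps qs + 4 + suc (length end))) X
        (slow (linear-bound n≤l)
           (depart (cong (λ x → reading ls x ∷ _) (++-assoc (replicate (length bss) true) _ rest))
             (op ⨾ op ⨾ readOrder-runs (length bss))))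
        (sequel (suc (length intro)) (entryWeight ps qs + 4 + suc (length end)) X
          (slow (const-bound (suc (length intro)) l) (emit-runs intro))
          (sequel (entryWeight ps qs + 4) (suc (length end)) X
            (slow (gridCost-bound (entryWeight ps qs) n≤l) r)
            (slow (const-bound (suc (length end)) l) (emit-runs end))))
      where
      X = suc l ^ 3

  module Translator (intro : List Bool) (ps qs : List Piece) (mid end : List Bool)
    (rs : List Piece) (final : List Bool) where

    -- The third pass runs on the counters left by the second conversion and therefore ranges over
    -- the vertex pairs of the second graph, although the input is already exhausted.
    translate : Prog 4
    translate = convert intro ps qs mid ⨾ convert intro ps qs end ⨾ grid (print rs) ⨾ emit final

    reducer : TM
    reducer = compile (translate ⨾ rewind)

    translateCost : ℕ
    translateCost =
      convertCost intro ps qs mid +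
        (convertCost intro ps qs end + (weight rs + 4 + suc (length final)))

    translation : List (List Bool) → List (List Bool) → List Bool
    translation bss bss₁ =
      (intro ++ gridText (entryText ps qs) 0 bss ++ mid) ++
      (intro ++ gridText (entryText ps qs) 0 bss₁ ++ end) ++
      gridText (copyText rs) 0 bss₁ ++ final

    private
      word³ : ∀ (u v w : List Bool) {acc} → (u ++ v ++ w) ʳ++ acc ≡ w ʳ++ (v ʳ++ (u ʳ++ acc))
      word³ u v w = trans (++-ʳ++ u) (++-ʳ++ v)

    module _ {bss bss₁ : List (List Bool)} (square : All (λ bs → length bs ≡ length bss) bss)
             (square₁ : All (λ bs → length bs ≡ length bss₁) bss₁) where

      private
        w : List Bool
        w = matrixWord bss ++ matrixWord bss₁
        l : ℕ
        l = length bss + length bss₁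
        X : ℕ
        X = suc l ^ 3

      translate-runs : ∃[ t ] ∃[ u ] ∃[ v ]
        Runs translate (reading [] w ∷ written [] ∷ blank ∷ blank ∷ []) (translateCost * X)
          (t ∷ written (translation bss bss₁ ʳ++ []) ∷ u ∷ v ∷ [])
      translate-runs
        with convert-runs intro ps qs mid bss {matrixWord bss₁} {l} {[]} {[]} {[]} {[]}
               (m≤m+n _ _) square
      ... | ls₁ , r₁
        with convert-runs intro ps qs end bss₁ {[]} {l} {_} {ls₁} {ones (length bss) []} {ones (length bss) []}
               (m≤n+m _ _) square₁
      ... | ls₂ , r₂
        with grid-runs {cell = print rs} {B = weight rs * suc l} {n = length bss₁}
               -- This pass consumes no input: the invariant keeps the tape fixed, and `bss₁` only
               -- prescribes the shape of the grid.
               {Input = λ _ t → t ≡ reading ls₂ []} {text = copyText rs}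
               (λ u<n v<n e → _ , e ,
                  print-runs (≤-trans (<⇒≤ u<n) (m≤n+m _ _)) (≤-trans (<⇒≤ v<n) (m≤n+m _ _)) rs)
               bss₁ {[]} square₁ refl refl
      ... | _ , refl , r₃ = _ , _ , _ ,
        land (cong (λ x → _ ∷ written x ∷ _ ∷ _ ∷ []) (sym acc-eq))
          (sequel (convertCost intro ps qs mid) (convertCost intro ps qs end + (weight rs + 4 + suc (length final))) X r₁
            (sequel (convertCost intro ps qs end) (weight rs + 4 + suc (length final)) X
              (depart (cong (λ x → reading ls₁ x ∷ _) (sym (++-identityʳ _))) r₂)
              (sequel (weight rs + 4) (suc (length final)) X
                (slow (gridCost-bound (weight rs) {length bss₁} {l} (m≤n+m _ _)) r₃)
                (slow (const-bound (suc (length final)) l) (emit-runs final)))))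
        where
        acc-eq : translation bss bss₁ ʳ++ [] ≡ final ʳ++ (gridText (copyText rs) 0 bss₁ ʳ++ (end ʳ++
                   (gridText (entryText ps qs) 0 bss₁ ʳ++ (intro ʳ++ (mid ʳ++
                   (gridText (entryText ps qs) 0 bss ʳ++ (intro ʳ++ [])))))))
        acc-eq = trans (++-ʳ++ (intro ++ gridText (entryText ps qs) 0 bss ++ mid))
          (trans (word³ (intro ++ gridText (entryText ps qs) 0 bss₁ ++ end) (gridText (copyText rs) 0 bss₁) final)
          (cong (λ x → final ʳ++ (gridText (copyText rs) 0 bss₁ ʳ++ x))
            (trans (word³ intro (gridText (entryText ps qs) 0 bss₁) end)
              (cong (λ x → end ʳ++ (gridText (entryText ps qs) 0 bss₁ ʳ++ (intro ʳ++ x)))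
                (word³ intro (gridText (entryText ps qs) 0 bss) mid)))))

      private
        module M = Run reducer

        -- Besides the unary order, a matrix word contains at least the separator. Strictness
        -- matters because the costs are polynomials in `suc l`.
        order≤ : l < length w
        order≤ = begin-strict
          length bss + length bss₁
            <⟨ +-mono-<-≤ (order< bss) (<⇒≤ (order< bss₁)) ⟩
          length (matrixWord bss) + length (matrixWord bss₁)
            ≡⟨ length-++ (matrixWord bss) ⟨
          length w ∎
          where
          open ≤-Reasoning
          order< : ∀ bss → length bss < length (matrixWord bss)
          order< bss = begin-strict
            length bss                                 ≡⟨ length-replicate (length bss) ⟨
            length (replicate (length bss) true)       <⟨ m<m+n _ (s≤s z≤n) ⟩
            length (replicate (length bss) true) + suc (length (concat bss))
              ≡⟨ length-++ (replicate (length bss) true) ⟨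
            length (matrixWord bss) ∎

      reducer-computes : ∃[ n ] ∃[ c ] n ≤ 3 * translateCost * length w ^ 3 + 3 ×
        M.initial w M.⇓[ n ] c × M.output c ≡ translation bss bss₁
      reducer-computes = _ , _ , ≤-trans (proj₁ (proj₂ halts)) cost , proj₂ (proj₂ halts) , out
        where
        r = proj₂ (proj₂ (proj₂ translate-runs))
        halts = run⇒⇓ (translate ⨾ rewind)
                  (depart (cong (_∷ _) (load-reading w)) (r ⨾ rewind-runs (translation bss bss₁ ʳ++ [])))
        out : unload (peekʳ (nothing ∷ []) (List.map just (translation bss bss₁ ʳ++ []) ʳ++ nothing ∷ []))
              ≡ translation bss bss₁
        out = trans (cong (λ x → unload (peekʳ (nothing ∷ []) x))
                (trans (cong (_ʳ++ nothing ∷ []) (map-ʳ++ just (translation bss bss₁)))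
                       (ʳ++-ʳ++ (List.map just (translation bss bss₁)))))
                (unload-peekʳ (translation bss bss₁) (nothing ∷ []))
        T : ℕ
        T = translateCost * X
        open ≤-Reasoning
        open +-*-Solver
        size : length (translation bss bss₁ ʳ++ []) ≤ T
        size = begin
          length (translation bss bss₁ ʳ++ [])                 ≡⟨ length-map just (translation bss bss₁ ʳ++ []) ⟨
          length (List.map just (translation bss bss₁ ʳ++ [])) ≤⟨ run-reach 1F r ⟩
          T + 0                                                ≡⟨ +-identityʳ T ⟩
          T                                                    ∎
        -- Translating takes `T` steps and writes at most `T` symbols, so rewinding takes at most
        -- `T * 2 + 3`; hence the factor 3 and the summand 3.
        cost : T + (length (translation bss bss₁ ʳ++ []) * 2 + 3) ≤ 3 * translateCost * length w ^ 3 + 3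
        cost = begin
          T + (length (translation bss bss₁ ʳ++ []) * 2 + 3)
            ≤⟨ +-monoʳ-≤ T (+-monoˡ-≤ 3 (*-monoˡ-≤ 2 size)) ⟩
          T + (T * 2 + 3)
            ≡⟨ solve 2 (λ c x → c :* x :+ (c :* x :* con 2 :+ con 3) := con 3 :* c :* x :+ con 3)
                 refl translateCost X ⟩
          3 * translateCost * X + 3
            ≤⟨ +-monoˡ-≤ 3 (*-monoʳ-≤ (3 * translateCost) (^-monoˡ-≤ 3 order≤)) ⟩
          3 * translateCost * length w ^ 3 + 3 ∎

-- The reduction

cells : ∀ m n → Vec (Fin m × Fin n) (m * n)
cells m n = Vec.concat (Vec.tabulate λ u → Vec.tabulate λ v → u , v)

lookup-cells : ∀ m n i → lookup (cells m n) i ≡ remQuot n i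
lookup-cells m n i = begin
  lookup (cells m n) i                      ≡⟨ cong (lookup (cells m n)) (combine-remQuot {m} n i) ⟨
  lookup (cells m n) (combine u v)          ≡⟨ lookup-concat rows u v ⟩
  lookup (lookup rows u) v                  ≡⟨ cong (λ r → lookup r v) (lookup∘tabulate _ u) ⟩
  lookup (Vec.tabulate (u ,_)) v            ≡⟨ lookup∘tabulate (u ,_) v ⟩
  (u , v)                                   ∎
  where
  open ≡-Reasoning
  rows = Vec.tabulate λ u → Vec.tabulate λ v → u , v
  u = proj₁ (remQuot {m} n i)
  v = proj₂ (remQuot {m} n i)

-- The zero separates the two unary numbers. It also keeps the name different from `[]`, which is
-- reserved for `pad`.
binder : ℕ → ℕ → 𝔸
binder u v = replicate u true ++ false ∷ replicate v true

binder-injective : ∀ u {u₁} v {v₁} → binder u v ≡ binder u₁ v₁ → u ≡ u₁ × v ≡ v₁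
binder-injective zero    {zero}   v {v₁} eq =
  refl , trans (sym (length-replicate v)) (trans (cong List.length (∷-injectiveʳ eq)) (length-replicate v₁))
binder-injective (suc u) {suc u₁} v eq with binder-injective u v (∷-injectiveʳ eq)
... | refl , e = refl , e

binder-nonempty : ∀ u v → binder u v ≢ []
binder-nonempty zero    v ()
binder-nonempty (suc u) v ()

binderAt : ∀ {m n} → Fin m × Fin n → 𝔸
binderAt (u , v) = binder (toℕ u) (toℕ v)

binderAt-injective : ∀ {m n} {p q : Fin m × Fin n} → binderAt p ≡ binderAt q → p ≡ q
binderAt-injective {p = u , v} {u₁ , v₁} eq with binder-injective (toℕ u) (toℕ v) eq
... | e , e₁ = cong₂ _,_ (toℕ-injective e) (toℕ-injective e₁)

binders : ∀ n → Vec 𝔸 (n * n)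
binders n = Vec.map binderAt (cells n n)

lookup-binders : ∀ n i → lookup (binders n) i ≡ binderAt (remQuot {n} n i)
lookup-binders n i = trans (lookup-map i binderAt (cells n n)) (cong binderAt (lookup-cells n n i))

lookup-binders-injective : ∀ n {i j} → lookup (binders n) i ≡ lookup (binders n) j → i ≡ j
lookup-binders-injective n {i} {j} eq = begin
  i                               ≡⟨ combine-remQuot {n} n i ⟨
  pack (remQuot {n} n i)          ≡⟨ cong pack (binderAt-injective (trans (sym (lookup-binders n i))
                                                  (trans eq (lookup-binders n j)))) ⟩
  pack (remQuot {n} n j)          ≡⟨ combine-remQuot {n} n j ⟩
  j                               ∎
  where
  open ≡-Reasoning
  pack : Fin n × Fin n → Fin (n * n)
  pack (u , v) = combine u v

binders-unique : ∀ n → Unique (binders n)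
binders-unique n =
  transport Unique (tabulate∘lookup (binders n))
    (Unique.tabulate⁺ (lookup-binders-injective n))

module Relocate {n} (as : Vec 𝔸 n) (injective : ∀ {i j} → lookup as i ≡ lookup as j → i ≡ j) where

  relocate : (Fin n → Fin n) → 𝔸 → 𝔸
  relocate g a with any? (λ i → lookup as i ≟ a)
  ... | yes (i , _) = lookup as (g i)
  ... | no _        = a

  relocate-lookup : ∀ g i → relocate g (lookup as i) ≡ lookup as (g i)
  relocate-lookup g i with any? (λ j → lookup as j ≟ lookup as i)
  ... | yes (j , eq) = cong (lookup as ∘ g) (injective eq)
  ... | no ∄         = contradiction (i , refl) ∄

  relocate-other : ∀ g {a} → ¬ (∃[ i ] lookup as i ≡ a) → relocate g a ≡ a
  relocate-other g {a} ∄ with any? (λ i → lookup as i ≟ a)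
  ... | yes ∃i = contradiction ∃i ∄
  ... | no _   = refl

  relocate-inverse : ∀ {g g₁} → (∀ i → g (g₁ i) ≡ i) → ∀ a → relocate g (relocate g₁ a) ≡ a
  relocate-inverse {g} {g₁} inv a = case (any? (λ i → lookup as i ≟ a))
    where
    case : Dec (∃[ i ] lookup as i ≡ a) → relocate g (relocate g₁ a) ≡ a
    case (yes (i , refl)) = trans (cong (relocate g) (relocate-lookup g₁ i))
                              (trans (relocate-lookup g (g₁ i)) (cong (lookup as) (inv i)))
    case (no ∄)           = trans (cong (relocate g) (relocate-other g₁ ∄)) (relocate-other g ∄)

  -- This permutation sends the (ρ i)-th atom back to the i-th one, as the letrec rule of _∼_ asks.
  relocation : Permutation′ n → Perm
  relocation ρ = mk↔ₛ′ (relocate (ρ ⟨$⟩ˡ_)) (relocate (ρ ⟨$⟩ʳ_))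
    (relocate-inverse (λ i → inverseˡ ρ)) (relocate-inverse (λ i → inverseʳ ρ))

  relocation-domain : ∀ ρ c → relocation ρ ·ᵃ c ≢ c → c ∈ᵛ as
  relocation-domain ρ c moved with any? (λ i → lookup as i ≟ c)
  ... | yes (i , refl) = ∈-lookup i as
  ... | no ∄           = contradiction refl moved

padTo : ∀ {A : Set} k → A → A → Vec A (suc k)
padTo zero    p y = y ∷ []
padTo (suc k) p y = p ∷ padTo k p y

-- The argument list of a symbol of arity `k` used as a binary one: only the first and the last
-- argument carry information.
frame : ∀ {A : Set} {k} → 2 ≤ k → A → A → A → Vec A k
frame {k = suc (suc k)} (s≤s (s≤s z≤n)) x p y = x ∷ padTo k p y

first : ∀ {k} → 2 ≤ k → ∃[ i ] (∀ {A : Set} (h : 2 ≤ k) (x p y : A) → lookup (frame h x p y) i ≡ x)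
first (s≤s (s≤s z≤n)) = zero , λ { (s≤s (s≤s z≤n)) x p y → refl }

final : ∀ {k} → 2 ≤ k → ∃[ i ] (∀ {A : Set} (h : 2 ≤ k) (x p y : A) → lookup (frame h x p y) i ≡ y)
final (s≤s (s≤s {n = k} z≤n)) = suc (proj₁ (pads k)) , λ { (s≤s (s≤s z≤n)) x p y → proj₂ (pads k) p y }
  where
  pads : ∀ k → ∃[ i ] (∀ {A : Set} (p y : A) → lookup (padTo k p y) i ≡ y)
  pads zero    = zero , λ p y → refl
  pads (suc k) = suc (proj₁ (pads k)) , proj₂ (pads k)

-- The two carriers may differ, so that with `⊤` as the second one this also transfers predicates,
-- as in `node-noLetrec`.
frame-rel : ∀ {A B : Set} {k} (_≈_ : A → B → Set) (h : 2 ≤ k) {x p y x₁ p₁ y₁} →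
  x ≈ x₁ → p ≈ p₁ → y ≈ y₁ → ∀ i → lookup (frame h x p y) i ≈ lookup (frame h x₁ p₁ y₁) i
frame-rel {k = suc (suc k)} _≈_ (s≤s (s≤s z≤n)) rx rp ry = λ { zero → rx ; (suc i) → pads k i }
  where
  pads : ∀ k i → lookup (padTo k _ _) i ≈ lookup (padTo k _ _) i
  pads zero    zero    = ry
  pads (suc k) zero    = rp
  pads (suc k) (suc i) = pads k i

-- The two letrec expressions of an instance

module Construction (S : Signature) (f : Signature.Sym S) (2≤ar : 2 ≤ Signature.ar S f) where
  open Signature S
  open Language S

  -- Its atom is not a binder, so the permutation that matches the environments leaves the filler
  -- literally unchanged.
  pad : ∀ {V} → Expr V
  pad = lam [] (atom [])

  node : ∀ {V} → Expr V → Expr V → Expr V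
  node x y = app f (frame 2≤ar x pad y)

  entry : ∀ {V} → ℕ → ℕ → Bool → Expr V
  entry u v b = node (atom (binder u u)) (atom (if b then binder v v else binder u u))

  Adj : ℕ → Set
  Adj n = Fin n → Fin n → Bool

  entryAt : ∀ {V n} → Adj n → Fin n × Fin n → Expr V
  entryAt adj (u , v) = entry (toℕ u) (toℕ v) (adj u v)

  entries : ∀ {V n} → Adj n → Vec (Expr V) (n * n)
  entries {n = n} adj = Vec.map (entryAt adj) (cells n n)

  lookup-entries : ∀ {V n} (adj : Adj n) i →
    lookup (entries {V} adj) i ≡ entryAt adj (remQuot {n} n i)
  lookup-entries {n = n} adj i =
    trans (lookup-map i (entryAt adj) (cells n n)) (cong (entryAt adj) (lookup-cells n n i))

  chain : ∀ {V n} → Vec 𝔸 n → Expr V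
  chain []       = pad
  chain (a ∷ as) = node (atom a) (chain as)

  source : ∀ {n} → Adj n → LRLX
  source {n} adj = letrec (binders n) (binders-unique n) (entries adj) (susp [] [])

  target : ∀ {n} → Adj n → LRL
  target {n} adj = letrec (binders n) (binders-unique n) (entries adj) (chain (binders n))

  module _ {V : Set} where

    vars*-padTo : ∀ k (p y : Expr V) → vars p ≡ [] → vars y ≡ [] → vars* (padTo k p y) ≡ []
    vars*-padTo zero    p y ep ey = cong (_++ []) ey
    vars*-padTo (suc k) p y ep ey = cong₂ _++_ ep (vars*-padTo k p y ep ey)

    vars*-frame : ∀ {k} (h : 2 ≤ k) {x p y : Expr V} → vars x ≡ [] → vars p ≡ [] → vars y ≡ [] →
      vars* (frame h x p y) ≡ []
    vars*-frame (s≤s (s≤s {n = k} z≤n)) {p = p} {y} ex ep ey = cong₂ _++_ ex (vars*-padTo k p y ep ey)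

    vars*-map : ∀ {A : Set} {n} (g : A → Expr V) → (∀ a → vars (g a) ≡ []) →
      (as : Vec A n) → vars* (Vec.map g as) ≡ []
    vars*-map g e []       = refl
    vars*-map g e (a ∷ as) = cong₂ _++_ (e a) (vars*-map g e as)

  source-once : ∀ {n} (adj : Adj n) → vars (source adj) ≡ [] ∷ []
  source-once {n} adj =
    cong (_++ [] ∷ []) (vars*-map (entryAt adj) (λ _ → vars*-frame 2≤ar refl refl refl) (cells n n))

  NoLetrec : LRL → Set
  NoLetrec t = ∀ {n} {as : Vec 𝔸 n} .{u : Unique as} {es r} → ¬ (letrec as u es r ⊑ t)

  node-noLetrec : ∀ {x y} → NoLetrec x → NoLetrec y → NoLetrec (node x y)
  node-noLetrec nx ny (app i sub) =
    frame-rel (λ t (_ : ⊤) → ∀ {n} {as : Vec 𝔸 n} .{u : Unique as} {es r} → ¬ (letrec as u es r ⊑ t))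
      2≤ar {x₁ = tt} {tt} {tt} nx (λ { (lam ()) }) ny i sub

  chain-noLetrec : ∀ {n} (as : Vec 𝔸 n) → NoLetrec (chain as)
  chain-noLetrec []       (lam ())
  chain-noLetrec (a ∷ as) = node-noLetrec (λ ()) (chain-noLetrec as)

  ∈-chain : ∀ {n} (as : Vec 𝔸 n) i → lookup as i ∈FA chain as
  ∈-chain (a ∷ as) zero    =
    app (proj₁ (first 2≤ar))
      (transport (a ∈FA_) (sym (proj₂ (first 2≤ar) 2≤ar _ _ _)) atom)
  ∈-chain (a ∷ as) (suc i) =
    app (proj₁ (final 2≤ar))
      (transport (lookup as i ∈FA_) (sym (proj₂ (final 2≤ar) 2≤ar _ _ _)) (∈-chain as i))

  -- The outermost letrec is the only one, and each of its binders is free in the chain; any member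
  -- of a supposed garbage set refutes the freshness condition on the body.
  target-garbageFree : ∀ {n} (adj : Adj n) → GarbageFree (target adj)
  target-garbageFree {n} adj (garbage here g (i , i∈g) _ fresh) = fresh i∈g (∈-chain (binders n) i)
  target-garbageFree {n} adj (garbage (rhs i sub) _ _ _ _) =
    node-noLetrec (λ ()) (λ ())
      (transport (_ ⊑_) (lookup-entries adj i) sub)
  target-garbageFree {n} adj (garbage (body sub) _ _ _ _)  = chain-noLetrec (binders n) sub

  module _ (σ : Var → LRL) where

    subst*-padTo : ∀ k (p y : LRLX) → subst* σ (padTo k p y) ≡ padTo k (subst σ p) (subst σ y)
    subst*-padTo zero    p y = refl
    subst*-padTo (suc k) p y = cong (subst σ p ∷_) (subst*-padTo k p y)

    subst*-frame : ∀ {k} (h : 2 ≤ k) (x p y : LRLX) →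
      subst* σ (frame h x p y) ≡ frame h (subst σ x) (subst σ p) (subst σ y)
    subst*-frame (s≤s (s≤s {n = k} z≤n)) x p y = cong (subst σ x ∷_) (subst*-padTo k p y)

    lookup-subst* : ∀ {n} (es : Vec LRLX n) i → lookup (subst* σ es) i ≡ subst σ (lookup es i)
    lookup-subst* (e ∷ es) zero    = refl
    lookup-subst* (e ∷ es) (suc i) = lookup-subst* es i

    lookup-subst*-entries : ∀ {n} (adj : Adj n) i →
      lookup (subst* σ (entries adj)) i ≡ entryAt adj (remQuot {n} n i)
    lookup-subst*-entries adj i =
      trans (lookup-subst* (entries adj) i)
        (trans (cong (subst σ) (lookup-entries adj i)) (cong (app f) (subst*-frame 2≤ar _ _ _)))

  module _ (π : Perm) where

    lookup-·* : ∀ {n} (es : Vec LRL n) i → lookup (π ·* es) i ≡ π · lookup es i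
    lookup-·* (e ∷ es) zero    = refl
    lookup-·* (e ∷ es) (suc i) = lookup-·* es i

    ·*-padTo : ∀ k (p y : LRL) → π ·* padTo k p y ≡ padTo k (π · p) (π · y)
    ·*-padTo zero    p y = refl
    ·*-padTo (suc k) p y = cong (π · p ∷_) (·*-padTo k p y)

    ·*-frame : ∀ {k} (h : 2 ≤ k) (x p y : LRL) → π ·* frame h x p y ≡ frame h (π · x) (π · p) (π · y)
    ·*-frame (s≤s (s≤s {n = k} z≤n)) x p y = cong (π · x ∷_) (·*-padTo k p y)

    module _ (fixed : π ·ᵃ [] ≡ []) where

      ·-node : ∀ x y → π · node x y ≡ node (π · x) (π · y)
      ·-node x y = cong (app f) (trans (·*-frame 2≤ar x pad y)
        (cong (λ a → frame 2≤ar (π · x) (lam a (atom a)) (π · y)) fixed))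

      ·-chain : ∀ {n} (as : Vec 𝔸 n) → π · chain as ≡ chain (Vec.map (π ·ᵃ_) as)
      ·-chain []       = cong (λ a → lam a (atom a)) fixed
      ·-chain (a ∷ as) = trans (·-node _ _) (cong (node _) (·-chain as))

  node-∼ : ∀ {x y x₁ y₁} → x ∼ x₁ → y ∼ y₁ → node x y ∼ node x₁ y₁
  node-∼ ex ey = app (frame-rel _∼_ 2≤ar ex (lam atom) ey)

  chain-refl : ∀ {n} (as : Vec 𝔸 n) → chain as ∼ chain as
  chain-refl []       = lam atom
  chain-refl (a ∷ as) = node-∼ atom (chain-refl as)

  -- From an isomorphism to a match

  module _ {n} (adj adj₁ : Adj n) (τ : Permutation′ n)
           (iso : ∀ u v → adj u v ≡ adj₁ (τ ⟨$⟩ʳ u) (τ ⟨$⟩ʳ v)) where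

    private
      ρ : Permutation′ (n * n)
      ρ = ↔-sym *↔× ↔-∘ ((τ ×-↔ τ) ↔-∘ *↔×)

      open Relocate (binders n) (lookup-binders-injective n)

      π : Perm
      π = relocation ρ

      at : Fin n × Fin n → Fin n × Fin n
      at (u , v) = τ ⟨$⟩ʳ u , τ ⟨$⟩ʳ v

      remQuot-ρ : ∀ i → remQuot {n} n (ρ ⟨$⟩ʳ i) ≡ at (remQuot {n} n i)
      remQuot-ρ i = remQuot-combine {n} _ _

      π-binders : ∀ i → π ·ᵃ lookup (binders n) (ρ ⟨$⟩ʳ i) ≡ lookup (binders n) i
      π-binders i = trans (relocate-lookup (ρ ⟨$⟩ˡ_) (ρ ⟨$⟩ʳ i)) (cong (lookup (binders n)) (inverseˡ ρ))

      π-binderAt : ∀ p → π ·ᵃ binderAt (at p) ≡ binderAt p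
      π-binderAt p@(u , v) = begin
        π ·ᵃ binderAt (at p)                    ≡⟨ cong (λ q → π ·ᵃ binderAt (at q)) (remQuot-combine u v) ⟨
        π ·ᵃ binderAt (at (remQuot {n} n i))    ≡⟨ cong (λ q → π ·ᵃ binderAt q) (remQuot-ρ i) ⟨
        π ·ᵃ binderAt (remQuot {n} n (ρ ⟨$⟩ʳ i)) ≡⟨ cong (π ·ᵃ_) (lookup-binders n (ρ ⟨$⟩ʳ i)) ⟨
        π ·ᵃ lookup (binders n) (ρ ⟨$⟩ʳ i)      ≡⟨ π-binders i ⟩
        lookup (binders n) i                    ≡⟨ lookup-binders n i ⟩
        binderAt (remQuot {n} n i)              ≡⟨ cong binderAt (remQuot-combine u v) ⟩
        binderAt p                              ∎
        where
        open ≡-Reasoning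
        i : Fin (n * n)
        i = combine u v

      π-[] : π ·ᵃ [] ≡ []
      π-[] = relocate-other (ρ ⟨$⟩ˡ_) λ (i , eq) →
        binder-nonempty _ _ (trans (sym (lookup-binders n i)) eq)

      π-entry : ∀ p → π · entryAt adj₁ (at p) ≡ entryAt adj p
      π-entry p@(u , v) = trans (·-node π π-[] _ _)
        (cong₂ (λ a b → node (atom a) (atom b)) (π-binderAt (u , u)) right)
        where
        right : π ·ᵃ (if adj₁ (τ ⟨$⟩ʳ u) (τ ⟨$⟩ʳ v)
                      then binderAt (at (v , v)) else binderAt (at (u , u)))
                ≡ (if adj u v then binderAt (v , v) else binderAt (u , u))
        right rewrite sym (iso u v) with adj u v
        ... | true  = π-binderAt (v , v)
        ... | false = π-binderAt (u , u)

      matcher : Vec 𝔸 (n * n)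
      matcher = Vec.map (π ·ᵃ_) (binders n)

    -- The bindings are reordered by `τ` on both coordinates and `π` undoes the renaming. The
    -- variable is sent to the body of the target renamed by `π`, so the condition on the bodies
    -- holds by the choice of `σ`.
    iso⇒match : ∃[ σ ] subst σ (source adj) ∼ target adj₁
    iso⇒match = σ , letrec ρ π
      (λ c moved → inj₁ (relocation-domain ρ c moved))
      π-binders
      -- Both letrecs bind the same atoms, so none of these is free in the target.
      (λ { i (rhs _ a∉ _) → a∉ (∈-lookup i (binders n)) ; i (body a∉ _) → a∉ (∈-lookup i (binders n)) })
      (subst₂ _∼_
        (sym (trans (·-chain (↔-id 𝔸) refl matcher) (cong chain (map-id matcher))))
        (sym (·-chain π π-[] (binders n)))
        (chain-refl matcher))
      (λ i → subst₂ _∼_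
        (sym (lookup-subst*-entries σ adj i))
        (sym (trans (cong (π ·_) (trans (lookup-entries adj₁ (ρ ⟨$⟩ʳ i)) (cong (entryAt adj₁) (remQuot-ρ i))))
                    (π-entry (remQuot {n} n i))))
        (node-∼ atom atom))
      where
      σ : Var → LRL
      σ _ = chain matcher

  -- From a match to an isomorphism

  LetrecMatch : LRL → LRL → Set
  LetrecMatch (letrec {n} as _ ss _) (letrec {m} bs _ ts _) =
    ∃[ ρ ] ∃[ π ] (∀ i → π ·ᵃ lookup bs (ρ ⟨$⟩ʳ i) ≡ lookup as i) ×
                  (∀ i → lookup ss i ∼ π · lookup ts (_⟨$⟩ʳ_ {n} {m} ρ i))
  LetrecMatch _ _ = ⊤

  -- Inversion of the letrec rule with independent lengths on the two sides. Matching directly on a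
  -- derivation for `source` and `target` would require unifying `n * n` with `m * m`.
  letrec-match : ∀ {s t} → s ∼ t → LetrecMatch s t
  letrec-match atom                     = tt
  letrec-match (app _)                  = tt
  letrec-match (lam _)                  = tt
  letrec-match (lamα _ _)               = tt
  letrec-match (letrec ρ π _ eq _ _ es) = ρ , π , eq , es

  node-atoms : ∀ {a b a₁ b₁} (π : Perm) → node (atom a) (atom b) ∼ π · node (atom a₁) (atom b₁) →
    a ≡ π ·ᵃ a₁ × b ≡ π ·ᵃ b₁
  node-atoms {a} {b} {a₁} {b₁} π (app es) =
    atoms (at (first 2≤ar)) , atoms (at (final 2≤ar))
    where
    atoms : ∀ {c d} → atom c ∼ atom d → c ≡ d
    atoms atom = refl
    at : ∀ {g : ∀ {A : Set} → A → A → A → A} → (∃[ i ] (∀ {A : Set} (h : 2 ≤ ar f) (x p y : A) →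
           lookup (frame h x p y) i ≡ g x p y)) →
         g (atom a) pad (atom b) ∼ π · g (atom a₁) pad (atom b₁)
    at (i , eq) = subst₂ _∼_ (eq 2≤ar _ _ _)
      (trans (lookup-·* π (frame 2≤ar (atom a₁) pad (atom b₁)) i) (cong (π ·_) (eq 2≤ar _ _ _)))
      (es i)

  -- Here `κ` is the bijection of matrix positions given by the reordering of bindings. It need not
  -- be of the form `τ` times `τ`: an off-diagonal non-edge may go to another such position of the
  -- corresponding row.
  module Recover {n m} (adj : Adj n) (adj₁ : Adj m)
    (irrefl : ∀ u → adj u u ≡ false) (irrefl₁ : ∀ u → adj₁ u u ≡ false)
    (π : Perm) (κ : (Fin n × Fin n) ↔ (Fin m × Fin m))
    (bound : ∀ p → binderAt p ≡ π ·ᵃ binderAt (Inverse.to κ p))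
    (matched : ∀ p → entryAt adj p ∼ π · entryAt adj₁ (Inverse.to κ p))
    where

    private
      to : Fin n × Fin n → Fin m × Fin m
      to = Inverse.to κ

      from : Fin m × Fin m → Fin n × Fin n
      from = Inverse.from κ

      to-from : ∀ q → to (from q) ≡ q
      to-from = Inverse.strictlyInverseˡ κ

      from-to : ∀ p → from (to p) ≡ p
      from-to = Inverse.strictlyInverseʳ κ

      left : ∀ p → binderAt {n} {n} (proj₁ p , proj₁ p) ≡
                   π ·ᵃ binderAt {m} {m} (proj₁ (to p) , proj₁ (to p))
      left p = proj₁ (node-atoms π (matched p))

      right : ∀ p {a b} → adj (proj₁ p) (proj₂ p) ≡ a → adj₁ (proj₁ (to p)) (proj₂ (to p)) ≡ b →
        (if a then binderAt {n} {n} (proj₂ p , proj₂ p) else binderAt {n} {n} (proj₁ p , proj₁ p)) ≡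
        π ·ᵃ (if b then binderAt {m} {m} (proj₂ (to p) , proj₂ (to p))
                   else binderAt {m} {m} (proj₁ (to p) , proj₁ (to p)))
      right p refl refl = proj₂ (node-atoms π (matched p))

      cancel : ∀ (p q : Fin m × Fin m) → π ·ᵃ binderAt p ≡ π ·ᵃ binderAt q → p ≡ q
      cancel p q eq = binderAt-injective (·ᵃ-injective π eq)

      -- The left argument of the entry at (u , u) is its own binder.
      diagonal : ∀ p → proj₁ p ≡ proj₂ p → proj₁ (to p) ≡ proj₂ (to p)
      diagonal p@(u , _) refl = cong proj₂ (cancel _ (to p) (trans (sym (left p)) (bound p)))

      diagonal⁻¹ : ∀ p → proj₁ (to p) ≡ proj₂ (to p) → proj₁ p ≡ proj₂ p
      diagonal⁻¹ p eq = cong proj₂ (binderAt-injective {p = proj₁ p , proj₁ p} {p}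
        (trans (left p) (trans (cong (λ v → π ·ᵃ binderAt (proj₁ (to p) , v)) eq) (sym (bound p)))))

      τ : Fin n → Fin m
      τ u = proj₁ (to (u , u))

      τ⁻¹ : Fin m → Fin n
      τ⁻¹ u = proj₁ (from (u , u))

      to-diagonal : ∀ u → to (u , u) ≡ (τ u , τ u)
      to-diagonal u = cong (τ u ,_) (sym (diagonal (u , u) refl))

      from-diagonal : ∀ u → from (u , u) ≡ (τ⁻¹ u , τ⁻¹ u)
      from-diagonal u = cong (τ⁻¹ u ,_) (sym (diagonal⁻¹ (from (u , u))
        (trans (cong proj₁ (to-from (u , u))) (sym (cong proj₂ (to-from (u , u)))))))

      ττ⁻¹ : ∀ u → τ (τ⁻¹ u) ≡ u
      ττ⁻¹ u = cong proj₁ (trans (cong to (sym (from-diagonal u))) (to-from (u , u)))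

      τ⁻¹τ : ∀ u → τ⁻¹ (τ u) ≡ u
      τ⁻¹τ u = cong proj₁ (trans (cong from (sym (to-diagonal u))) (from-to (u , u)))

      left-τ : ∀ u → binderAt {n} {n} (u , u) ≡ π ·ᵃ binderAt {m} {m} (τ u , τ u)
      left-τ u = left (u , u)

      -- All entries of a row share their left argument, the diagonal binder of the row. Comparing
      -- `left` at `p` with `left` on the diagonal and cancelling `π` shows that `κ` maps rows to
      -- rows.
      row-τ : ∀ p → proj₁ (to p) ≡ τ (proj₁ p)
      row-τ p = cong proj₁ (cancel (proj₁ (to p) , proj₁ (to p)) (τ (proj₁ p) , τ (proj₁ p))
                  (trans (sym (left p)) (left-τ (proj₁ p))))

      -- At a non-edge both arguments of the entry coincide. If an edge were sent to a non-edge, its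
      -- own two arguments would coincide as well, and it would be a loop. Once the image is an
      -- edge, the right arguments determine its column.
      edge : ∀ p b → adj₁ (proj₁ (to p)) (proj₂ (to p)) ≡ b → adj (proj₁ p) (proj₂ p) ≡ true →
             proj₂ (to p) ≡ τ (proj₂ p) × b ≡ true
      edge p true  e₁ e =
        cong proj₁ (cancel (proj₂ (to p) , proj₂ (to p)) (τ (proj₂ p) , τ (proj₂ p))
          (trans (sym (right p e e₁)) (left-τ (proj₂ p)))) , refl
      edge p false e₁ e = contradiction (trans (sym e) (trans (cong (adj (proj₁ p)) coincide) (irrefl (proj₁ p)))) λ ()
        where
        coincide : proj₂ p ≡ proj₁ p
        coincide = cong proj₁ (binderAt-injective {p = proj₂ p , proj₂ p} {proj₁ p , proj₁ p}
                 (trans (right p e e₁) (sym (left p))))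

      edge⁻¹ : ∀ p b → adj (proj₁ p) (proj₂ p) ≡ b → adj₁ (proj₁ (to p)) (proj₂ (to p)) ≡ true → b ≡ true
      edge⁻¹ p true  e e₁ = refl
      edge⁻¹ p false e e₁ =
        contradiction (trans (sym e₁) (trans (cong (adj₁ (proj₁ (to p))) coincide) (irrefl₁ (proj₁ (to p))))) λ ()
        where
        coincide : proj₂ (to p) ≡ proj₁ (to p)
        coincide = cong proj₁ (cancel (proj₂ (to p) , proj₂ (to p)) (proj₁ (to p) , proj₁ (to p))
                 (trans (sym (right p e e₁)) (left p)))

      edge-τ : ∀ u v → adj u v ≡ true → adj₁ (τ u) (τ v) ≡ true
      edge-τ u v e = trans (sym (cong₂ adj₁ (row-τ (u , v)) (proj₁ both))) (proj₂ both)
        where both = edge (u , v) _ refl e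

      -- Where `κ` sends `(u , v)` is unknown until this is known to be an edge. So the given edge
      -- is pulled back along `κ`, and `edge` identifies the resulting position with `(u , v)`.
      edge-τ⁻¹ : ∀ u v → adj₁ (τ u) (τ v) ≡ true → adj u v ≡ true
      edge-τ⁻¹ u v e = trans (sym (cong₂ adj (τ-injective row≡) (τ-injective col≡))) e₀
        where
        p : Fin n × Fin n
        p = from (τ u , τ v)
        to-p : to p ≡ (τ u , τ v)
        to-p = to-from (τ u , τ v)
        e₀ : adj (proj₁ p) (proj₂ p) ≡ true
        e₀ = edge⁻¹ p _ refl (trans (cong (λ q → adj₁ (proj₁ q) (proj₂ q)) to-p) e)
        τ-injective : ∀ {u v} → τ u ≡ τ v → u ≡ v
        τ-injective {u} {v} eq = trans (sym (τ⁻¹τ u)) (trans (cong τ⁻¹ eq) (τ⁻¹τ v))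
        row≡ : τ (proj₁ p) ≡ τ u
        row≡ = trans (sym (row-τ p)) (cong proj₁ to-p)
        col≡ : τ (proj₂ p) ≡ τ v
        col≡ = trans (sym (proj₁ (edge p _ refl e₀))) (cong proj₂ to-p)

    isomorphism : Σ[ τ ∈ Permutation n m ] (∀ u v → adj u v ≡ adj₁ (τ ⟨$⟩ʳ u) (τ ⟨$⟩ʳ v))
    isomorphism = permutation τ τ⁻¹ ττ⁻¹ τ⁻¹τ , λ u v → agree (edge-τ u v) (edge-τ⁻¹ u v)
      where
      agree : ∀ {a b : Bool} → (a ≡ true → b ≡ true) → (b ≡ true → a ≡ true) → a ≡ b
      agree {true}  {b}     f g = sym (f refl)
      agree {false} {false} f g = refl
      agree {false} {true}  f g = g refl

  module _ {n m} (adj : Adj n) (adj₁ : Adj m)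
    (irrefl : ∀ u → adj u u ≡ false) (irrefl₁ : ∀ u → adj₁ u u ≡ false) where

    private
      recover : ∀ σ (ρ : Permutation (n * n) (m * m)) (π : Perm) →
        (∀ i → π ·ᵃ lookup (binders m) (ρ ⟨$⟩ʳ i) ≡ lookup (binders n) i) →
        (∀ i → lookup (subst* σ (entries adj)) i ∼ π · lookup (entries adj₁) (ρ ⟨$⟩ʳ i)) →
        Σ[ τ ∈ Permutation n m ] (∀ u v → adj u v ≡ adj₁ (τ ⟨$⟩ʳ u) (τ ⟨$⟩ʳ v))
      recover σ ρ π bound matched = Recover.isomorphism adj adj₁ irrefl irrefl₁ π
        (*↔× ↔-∘ (ρ ↔-∘ ↔-sym *↔×)) bound-at matched-at
        where
        at : Fin n × Fin n → Fin (n * n)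
        at (u , v) = combine u v
        bound-at : ∀ p → binderAt p ≡ π ·ᵃ binderAt (remQuot {m} m (ρ ⟨$⟩ʳ at p))
        bound-at p@(u , v) = begin
          binderAt p                                       ≡⟨ cong binderAt (remQuot-combine u v) ⟨
          binderAt (remQuot {n} n (at p))                  ≡⟨ lookup-binders n (at p) ⟨
          lookup (binders n) (at p)                        ≡⟨ bound (at p) ⟨
          π ·ᵃ lookup (binders m) (ρ ⟨$⟩ʳ at p)            ≡⟨ cong (π ·ᵃ_) (lookup-binders m (ρ ⟨$⟩ʳ at p)) ⟩
          π ·ᵃ binderAt (remQuot {m} m (ρ ⟨$⟩ʳ at p))      ∎
          where open ≡-Reasoning
        matched-at : ∀ p → entryAt adj p ∼ π · entryAt adj₁ (remQuot {m} m (ρ ⟨$⟩ʳ at p))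
        matched-at p@(u , v) = subst₂ _∼_
          (trans (lookup-subst*-entries σ adj (at p)) (cong (entryAt adj) (remQuot-combine u v)))
          (cong (π ·_) (lookup-entries adj₁ (ρ ⟨$⟩ʳ at p)))
          (matched (at p))

    match⇒iso : (∃[ σ ] subst σ (source adj) ∼ target adj₁) →
      Σ[ τ ∈ Permutation n m ] (∀ u v → adj u v ≡ adj₁ (τ ⟨$⟩ʳ u) (τ ⟨$⟩ʳ v))
    match⇒iso (σ , match) with letrec-match match
    ... | ρ , π , bound , matched = recover σ ρ π bound matched

-- The output of the program

module _ {A : Set} {text : ℕ → ℕ → Bool → List Bool} {c : A → List Bool} where

  rowText-tabulate : ∀ {n} {g : Fin n → Bool} {a : Fin n → A} u j →
    (∀ v → text u (j + toℕ v) (g v) ≡ c (a v)) →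
    rowText text u j (List.tabulate g) ≡ concatMap c (Vec.toList (Vec.tabulate a))
  rowText-tabulate {zero}          u j h = refl
  rowText-tabulate {suc n} {g} {a} u j h = cong₂ _++_
    (trans (cong (λ x → text u x (g zero)) (sym (+-identityʳ j))) (h zero))
    (rowText-tabulate u (suc j) λ v → trans (cong (λ x → text u x (g (suc v))) (sym (+-suc j (toℕ v)))) (h (suc v)))

  gridText-tabulate : ∀ {m n} {g : Fin m → Fin n → Bool} {a : Fin m → Fin n → A} i →
    (∀ u v → text (i + toℕ u) (toℕ v) (g u v) ≡ c (a u v)) →
    gridText text i (List.tabulate λ u → List.tabulate (g u))
    ≡ concatMap c (Vec.toList (Vec.concat (Vec.tabulate λ u → Vec.tabulate (a u))))
  gridText-tabulate {zero}                  i h = refl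
  gridText-tabulate {suc m} {n} {g} {a} i h = begin
    rowText text i 0 (List.tabulate (g zero)) ++
    gridText text (suc i) (List.tabulate λ u → List.tabulate (g (suc u)))
      ≡⟨ cong₂ _++_
           (rowText-tabulate i 0 λ v → trans (cong (λ x → text x (toℕ v) (g zero v)) (sym (+-identityʳ i))) (h zero v))
           (gridText-tabulate {g = λ u → g (suc u)} {λ u → a (suc u)} (suc i) λ u v →
              trans (cong (λ x → text x (toℕ v) (g (suc u) v)) (sym (+-suc i (toℕ u)))) (h (suc u) v)) ⟩
    concatMap c (Vec.toList (Vec.tabulate (a zero))) ++ concatMap c (Vec.toList rest)
      ≡⟨ concatMap-++ c (Vec.toList (Vec.tabulate (a zero))) (Vec.toList rest) ⟨
    concatMap c (Vec.toList (Vec.tabulate (a zero)) ++ Vec.toList rest)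
      ≡⟨ cong (concatMap c) (toList-++ (Vec.tabulate (a zero)) rest) ⟨
    concatMap c (Vec.toList (Vec.tabulate (a zero) Vec.++ rest)) ∎
    where
    open ≡-Reasoning
    rest = Vec.concat (Vec.tabulate λ u → Vec.tabulate (a (suc u)))

matrix : ∀ {n} → (Fin n → Fin n → Bool) → List (List Bool)
matrix adj = List.tabulate λ u → List.tabulate (adj u)

matrix-square : ∀ {n} (adj : Fin n → Fin n → Bool) → All (λ bs → length bs ≡ length (matrix adj)) (matrix adj)
matrix-square adj = All.tabulate⁺ λ u → trans (length-tabulate (adj u)) (sym (length-tabulate _))

encode-graph-matrix : ∀ G → matrixWord (matrix (Graph.adj G)) ≡ encode-graph G
encode-graph-matrix G = cong₂ (λ n w → replicate n true ++ false ∷ w) (length-tabulate _)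
  (cong concat (sym (trans (map-tabulate id _) (tabulate-cong λ u → map-tabulate id (Graph.adj G u)))))

-- The encoded instance as a text of pieces

module Text (S : Signature) (f : Signature.Sym S) (2≤ar : 2 ≤ Signature.ar S f) where
  open Signature S
  open Language S
  open Construction S f 2≤ar

  code : List Token → List Bool
  code = concatMap bits

  open Print (bits (bit true))
  open Reduction (bits (bit true))

  code-++ : ∀ xs ys → code (xs ++ ys) ≡ code xs ++ code ys
  code-++ = concatMap-++ bits

  attach : ∀ xs ys {w} → w ≡ code ys → code xs ++ w ≡ code (xs ++ ys)
  attach xs ys eq = trans (cong (code xs ++_) eq) (sym (code-++ xs ys))

  intermediate : ∀ {k} → 2 ≤ k → List Token → List Token
  intermediate (s≤s (s≤s {n = k} z≤n)) ts = concat (replicate k ts)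

  symbol padTokens padding : List Token
  symbol    = app ∷ write (name f)
  padTokens = lam ∷ end ∷ atom ∷ end ∷ []
  padding   = intermediate 2≤ar padTokens

  module _ {V : Set} (ν : V → Name) where

    tokens*-padTo : ∀ k p y →
      tokens* ν (padTo k p y) ≡ concat (replicate k (tokens ν p)) ++ tokens ν y
    tokens*-padTo zero    p y = ++-identityʳ (tokens ν y)
    tokens*-padTo (suc k) p y =
      trans (cong (tokens ν p ++_) (tokens*-padTo k p y)) (sym (++-assoc (tokens ν p) _ _))

    tokens*-frame : ∀ {k} (h : 2 ≤ k) x p y →
      tokens* ν (frame h x p y) ≡ tokens ν x ++ intermediate h (tokens ν p) ++ tokens ν y
    tokens*-frame (s≤s (s≤s {n = k} z≤n)) x p y = cong (tokens ν x ++_) (tokens*-padTo k p y)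

    tokens-node : ∀ x y → tokens ν (node x y) ≡ symbol ++ tokens ν x ++ padding ++ tokens ν y
    tokens-node x y = cong (symbol ++_) (tokens*-frame 2≤ar x pad y)

    code-bindings : ∀ {A : Set} (a : A → 𝔸) (e : A → Expr V) {n} (xs : Vec A n) →
      code (bindings ν (Vec.map a xs) (Vec.map e xs))
      ≡ concatMap (λ x → code (lam ∷ write (a x) ++ tokens ν (e x))) (Vec.toList xs)
    code-bindings a e []       = refl
    code-bindings a e (x ∷ xs) =
      trans (cong code (sym (++-assoc (lam ∷ write (a x)) (tokens ν (e x)) _)))
        (sym (attach (lam ∷ write (a x) ++ tokens ν (e x)) (bindings ν (Vec.map a xs) (Vec.map e xs)) (sym (code-bindings a e xs))))

    -- The tail of a chain is the last argument of `f`, so in prefix notation nothing follows it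
    -- within its node. The text of a chain is therefore a plain sequence of such links, which one
    -- pass over the grid can print.
    link : 𝔸 → List Token
    link a = symbol ++ (atom ∷ write a) ++ padding

    code-chain : ∀ {A : Set} (a : A → 𝔸) {n} (xs : Vec A n) →
      code (tokens ν (chain (Vec.map a xs))) ≡ concatMap (λ x → code (link (a x))) (Vec.toList xs) ++ code padTokens
    code-chain a []       = refl
    code-chain a (x ∷ xs) = begin
      code (tokens ν (node (atom (a x)) (chain (Vec.map a xs))))
        ≡⟨ cong code (tokens-node _ _) ⟩
      code (symbol ++ (atom ∷ write (a x)) ++ padding ++ tail)
        ≡⟨ cong (λ y → code (symbol ++ y)) (++-assoc (atom ∷ write (a x)) padding tail) ⟨
      code (symbol ++ ((atom ∷ write (a x)) ++ padding) ++ tail)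
        ≡⟨ cong code (++-assoc symbol _ tail) ⟨
      code (link (a x) ++ tail)
        ≡⟨ attach (link (a x)) tail (sym (code-chain a xs)) ⟨
      code (link (a x)) ++ concatMap (λ y → code (link (a y))) (Vec.toList xs) ++ code padTokens
        ≡⟨ ++-assoc (code (link (a x))) _ (code padTokens) ⟨
      (code (link (a x)) ++ concatMap (λ y → code (link (a y))) (Vec.toList xs)) ++ code padTokens ∎
      where
      open ≡-Reasoning
      tail = tokens ν (chain (Vec.map a xs))

  namePieces : Counter → Counter → List Piece
  namePieces c d = unary c ∷ word (bits (bit false)) ∷ unary d ∷ word (bits end) ∷ []

  -- The two kinds of entries differ only in the last name: `c` is `col` for an entry 1 and `row`
  -- for an entry 0.
  entryPieces : Counter → List Piece
  entryPieces c =
    word (code (lam ∷ [])) ∷ namePieces row col ++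
    word (code (symbol ++ atom ∷ [])) ∷ namePieces row row ++
    word (code (padding ++ atom ∷ [])) ∷ namePieces c c

  linkPieces : List Piece
  linkPieces =
    word (code (symbol ++ atom ∷ [])) ∷ namePieces row col ++ word (code padding) ∷ []

  module _ (u v : ℕ) where

    spell-name : ∀ c d →
      concatMap (spell u v) (namePieces c d) ≡ code (write (binder (value u v c) (value u v d)))
    spell-name c d = first-part (value u v c)
      where
      y = value u v d
      second-part : ∀ y → concat (replicate y (bits (bit true))) ++ bits end ++ [] ≡ code (write (replicate y true))
      second-part zero    = refl
      second-part (suc y) = cong (bits (bit true) ++_) (second-part y)
      first-part : ∀ x → concat (replicate x (bits (bit true))) ++ bits (bit false) ++
                         concat (replicate y (bits (bit true))) ++ bits end ++ [] ≡ code (write (binder x y))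
      first-part zero    = cong (bits (bit false) ++_) (second-part y)
      first-part (suc x) = cong (bits (bit true) ++_) (first-part x)

    -- Wrapping the equation keeps `ps` and `ts` inferable when steps are composed; the two words
    -- alone do not determine them.
    record Spells (ps : List Piece) (ts : List Token) : Set where
      constructor spells
      field
        spelled : concatMap (spell u v) ps ≡ code ts

    open Spells

    then-word : ∀ xs {ps ys} → Spells ps ys → Spells (word (code xs) ∷ ps) (xs ++ ys)
    then-word xs {ys = ys} (spells eq) = spells (attach xs ys eq)

    then-name : ∀ c d {ps ys} → Spells ps ys →
      Spells (namePieces c d ++ ps) (write (binder (value u v c) (value u v d)) ++ ys)
    then-name c d {ps} {ys} (spells eq) = spells
      (trans (concatMap-++ (spell u v) (namePieces c d) ps)
        (trans (cong (_++ concatMap (spell u v) ps) (spell-name c d))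
          (attach (write (binder (value u v c) (value u v d))) ys eq)))

    spell-entryPieces : ∀ {V : Set} (ν : V → Name) c →
      concatMap (spell u v) (entryPieces c) ≡
      code (lam ∷ write (binder u v) ++
            tokens ν (node (atom (binder u u)) (atom (binder (value u v c) (value u v c)))))
    spell-entryPieces ν c = trans
      (spelled (then-word (lam ∷ []) (then-name row col
        (then-word (symbol ++ atom ∷ []) (then-name row row
          (then-word (padding ++ atom ∷ []) (spells {ps = namePieces c c} (spell-name c c))))))))
      (cong (λ ts → code (lam ∷ write (binder u v) ++ ts))
        (trans (++-assoc symbol (atom ∷ []) _)
          (trans (cong (λ ts → symbol ++ (atom ∷ write (binder u u)) ++ ts) (++-assoc padding (atom ∷ []) _))
            (sym (tokens-node ν _ _)))))

    spell-entry : ∀ {V : Set} (ν : V → Name) b →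
      entryText (entryPieces col) (entryPieces row) u v b
      ≡ code (lam ∷ write (binder u v) ++ tokens ν (entry u v b))
    spell-entry ν true  = spell-entryPieces ν col
    spell-entry ν false = spell-entryPieces ν row

    spell-link : ∀ {V : Set} (ν : V → Name) → concatMap (spell u v) linkPieces ≡ code (link ν (binder u v))
    spell-link ν = trans
      (spelled (then-word (symbol ++ atom ∷ []) (then-name row col
        (spells {ps = word (code padding) ∷ []} (++-identityʳ (code padding))))))
      (cong code (++-assoc symbol (atom ∷ []) _))

  entriesText linksText : ∀ {n} → Adj n → List Bool
  entriesText adj = gridText (entryText (entryPieces col) (entryPieces row)) 0 (matrix adj)
  linksText   adj = gridText (copyText linkPieces) 0 (matrix adj)

  entriesText-bindings : ∀ {V : Set} (ν : V → Name) {n} (adj : Adj n) →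
    entriesText adj ≡ code (bindings ν (binders n) (entries adj))
  entriesText-bindings ν {n} adj =
    trans (gridText-tabulate {c = λ p → code (lam ∷ write (binderAt p) ++ tokens ν (entryAt adj p))} {a = _,_} 0
            λ u v → spell-entry (toℕ u) (toℕ v) ν (adj u v))
      (sym (code-bindings ν binderAt (entryAt adj) (cells n n)))

  linksText-chain : ∀ {V : Set} (ν : V → Name) {n} (adj : Adj n) →
    linksText adj ++ code padTokens ≡ code (tokens ν (chain (binders n)))
  linksText-chain ν {n} adj =
    trans (cong (_++ code padTokens) (gridText-tabulate {text = copyText linkPieces} {λ p → code (link ν (binderAt p))} {g = adj} {_,_} 0
                                    λ u v → spell-link (toℕ u) (toℕ v) ν))
      (sym (code-chain ν binderAt (cells n n)))

  -- The three `end` tokens of `sourceEnd` close the environment, the empty list of swappings and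
  -- the empty name of the variable.
  letrecWord sourceEnd targetMid : List Token
  letrecWord = letrec ∷ []
  sourceEnd  = end ∷ susp ∷ end ∷ end ∷ []
  targetMid  = end ∷ []

  open Translator (code letrecWord) (entryPieces col) (entryPieces row)
    (code sourceEnd) (code targetMid) linkPieces (code padTokens) public

  translation-tokens : ∀ {n m} (adj : Adj n) (adj₁ : Adj m) →
    translation (matrix adj) (matrix adj₁)
    ≡ code (tokens id (source adj) ++ tokens ⊥-elim (target adj₁))
  translation-tokens {n} {m} adj adj₁ = trans
    (cong₂ _++_
      (attach letrecWord (bindings id (binders n) (entries adj) ++ sourceEnd)
        (trans (cong (_++ code sourceEnd) (entriesText-bindings id adj))
        (sym (code-++ (bindings id (binders n) (entries adj)) sourceEnd))))
      (trans (++-assoc (code letrecWord) (entriesText adj₁ ++ code targetMid) _)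
        (attach letrecWord (bindings ⊥-elim (binders m) (entries adj₁) ++ targetMid ++ tokens ⊥-elim (chain (binders m)))
          (trans (++-assoc (entriesText adj₁) (code targetMid) _)
          (trans (cong (_++ code targetMid ++ linksText adj₁ ++ code padTokens) (entriesText-bindings ⊥-elim adj₁))
            (attach (bindings ⊥-elim (binders m) (entries adj₁)) (targetMid ++ tokens ⊥-elim (chain (binders m)))
              (attach targetMid (tokens ⊥-elim (chain (binders m))) (linksText-chain ⊥-elim adj₁))))))))
    (sym (code-++ (tokens id (source adj)) (tokens ⊥-elim (target adj₁))))

theorem7p2 : (S : Signature) (f : Signature.Sym S) → 2 ≤ Signature.ar S f →
    GraphIsomorphism ≤ₚ Language.Matching S
theorem7p2 S f 2≤ar = instanceOf , polytime , λ (G , H) → mk⇔ (forth G H) (back G H)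
  where
  open Language S
  open Construction S f 2≤ar
  open Text S f 2≤ar

  instanceOf : Graph × Graph → MatchingInstance
  instanceOf (G , H) = record
    { s            = source (Graph.adj G)
    ; t            = target (Graph.adj H)
    ; X            = []
    ; once         = source-once (Graph.adj G)
    ; garbage-free = target-garbageFree (Graph.adj H)
    }

  forth : ∀ G H → G ≅ H → ∃[ σ ] subst σ (source (Graph.adj G)) ∼ target (Graph.adj H)
  -- Taking the records apart turns the orders into variables, so that `refl` can identify them.
  forth record { adj = adj } record { adj = adj₁ } (τ , iso) with ↔⇒≡ τ
  ... | refl = iso⇒match adj adj₁ τ iso

  back : ∀ G H → (∃[ σ ] subst σ (source (Graph.adj G)) ∼ target (Graph.adj H)) → G ≅ H
  back G H = match⇒iso (Graph.adj G) (Graph.adj H) (Graph.irrefl G) (Graph.irrefl H)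

  polytime : PolyTime GraphIsomorphism Matching instanceOf
  polytime = record
    { machine  = reducer
    ; c        = 3 * translateCost
    ; d        = 3
    ; e        = 3
    ; computes = λ (G , H) → subst₂
        (λ w o → ∃[ n ] ∃[ final ]
           n ≤ 3 * translateCost * length w ^ 3 + 3 × initial w ⇓[ n ] final × output final ≡ o)
        (cong₂ _++_ (encode-graph-matrix G) (encode-graph-matrix H))
        (translation-tokens (Graph.adj G) (Graph.adj H))
        (reducer-computes (matrix-square (Graph.adj G)) (matrix-square (Graph.adj H)))
    }
    where open Run reducer
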